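{- Let $m,n\ge 1$ be integers and let $T^*_{3,m,n}$ be the tree described in the context. Then the independence polynomial $I_{T^*_{3,m,n}}(t)$ is unimodal.
   Context: For a finite simple graph $G$, let $i_k$ be the number of independent sets of $G$ of size $k$ (with $i_0=1$), and $I_G(t)=\sum_{k\ge 0} i_k t^k$ the independence polynomial. A polynomial is unimodal if its coefficient sequence $a_0,\dots,a_d$ satisfies $a_0\le\cdots\le a_j\ge a_{j+1}\ge\cdots\ge a_d$ for some $j$. The tree $T_{3,m,n}$: a root $v_0$ with three children $v_1,v_2,v_3$; $v_1$ has children $v_{11},v_{12},v_{13}$, $v_2$ has children $v_{21},\dots,v_{2m}$, $v_3$ has children $v_{31},\dots,v_{3n}$; each $v_{ij}$ has exactly one further child $v'_{ij}$, a leaf. The tree $T^*_{3,m,n}$ is obtained from $T_{3,m,n}$ by adding two new vertices $x,y$ and edges $v'_{13}x$ and $xy$ (i.e. the edge $v_{13}v'_{13}$ is replaced by a path $v_{13},v'_{13},x,y$ on four vertices). -}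

module Defs where

open import Data.Nat using (ℕ; zero; suc; _+_; _*_; _≤_; _<_; _≡ᵇ_; _⊔_)
open import Data.Bool using (Bool; true; false; _∧_; not; if_then_else_)
open import Data.List using (List; []; _∷_; _++_; map; filter; length; upTo; foldr; concatMap)
open import Data.Vec using (Vec; []; _∷_)
open import Data.Product using (Σ; _×_; _,_)
open import Relation.Binary.PropositionalEquality using (_≡_)
open import Data.Bool.Properties using (T?)

-- Finite simple graphs on the vertex set {0,…,V-1}, given by an edge list.

record Graph : Set where
  field
    V : ℕ
    E : List (ℕ × ℕ)          -- edges {u,v}, with u,v < V, u ≠ v

open Graph public

Subset : ℕ → Set
Subset n = Vec Bool n

mem : ∀ {n} → Subset n → ℕ → Bool
mem []            _       = false
mem (b ∷ _)       zero    = b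
mem (_ ∷ s)       (suc i) = mem s i

size : ∀ {n} → Subset n → ℕ
size []            = 0
size (true  ∷ s)   = suc (size s)
size (false ∷ s)   = size s

allSubsets : (n : ℕ) → List (Subset n)
allSubsets zero    = [] ∷ []
allSubsets (suc n) = map (true ∷_) (allSubsets n) ++ map (false ∷_) (allSubsets n)

independent : (G : Graph) → Subset (V G) → Bool
independent G S = foldr (λ e acc → not (mem S (Data.Product.proj₁ e) ∧ mem S (Data.Product.proj₂ e)) ∧ acc) true (E G)

indepSets : (G : Graph) → List (Subset (V G))
indepSets G = filter (λ S → T? (independent G S)) (allSubsets (V G))

indepCount : Graph → ℕ → ℕ
indepCount G k = length (filter (λ S → T? (size S ≡ᵇ k)) (indepSets G))

indepNumber : Graph → ℕ
indepNumber G = foldr (λ S acc → size S ⊔ acc) 0 (indepSets G)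

Unimodal : (a : ℕ → ℕ) (d : ℕ) → Set
Unimodal a d = Σ ℕ λ j → j ≤ d
  × (∀ i → i < j → a i ≤ a (suc i))
  × (∀ i → j ≤ i → i < d → a (suc i) ≤ a i)

IndepPolyUnimodal : Graph → Set
IndepPolyUnimodal G = Unimodal (indepCount G) (indepNumber G)

-- The tree T*_{3,m,n}.
-- Labels: v0 = 0, v1 = 1, v2 = 2, v3 = 3;
--   v_{1j} = 4+2j, v'_{1j} = 5+2j          (j = 0,1,2; so v_{13} = 8, v'_{13} = 9)
--   v_{2j} = 10+2j, v'_{2j} = 11+2j        (j = 0,…,m-1)
--   v_{3j} = 10+2m+2j, v'_{3j} = 11+2m+2j  (j = 0,…,n-1)
--   x = 10+2m+2n, y = 11+2m+2n.

branch : (c o k : ℕ) → List (ℕ × ℕ)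
branch c o k = concatMap (λ j → (c , o + 2 * j) ∷ (o + 2 * j , o + 2 * j + 1) ∷ []) (upTo k)

Tstar : (m n : ℕ) → Graph
Tstar m n = record
  { V = 12 + 2 * m + 2 * n
  ; E = (0 , 1) ∷ (0 , 2) ∷ (0 , 3)
      ∷ (9 , 10 + 2 * m + 2 * n) ∷ (10 + 2 * m + 2 * n , 11 + 2 * m + 2 * n)
      ∷ (branch 1 4 3 ++ branch 2 10 m ++ branch 3 (10 + 2 * m) n)
  }

{-# OPTIONS --safe #-}
-- Put N = m + n. Summing over the membership of v₂ and v₃ gives
--   I(t) = Q (1+2t)^N + B ((1+2t)^m (1+t)^n + (1+t)^m (1+2t)^n) + t B (1+t)^N
-- for two fixed polynomials Q and B, and the first term dominates. With p = ⌊2N/3⌋ + 3 the coefficients increase up to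
-- index p and decrease from index p + 1 on; either order of the coefficients p and p + 1 then gives unimodality.
-- As 1 + t is the mean of 1 and 1 + 2t, it suffices to know the signs of the coefficients of
-- (1-t) (Q (1+2t)^N + c B' (1+2t)^K) for K < N, where B' is (1+t) B or (1+t) t B. When N - K is large, they follow
-- from those with smaller N - K, because B' (1+2t)^K peaks much earlier than Q (1+2t)^N. When N - K is small, the
-- polynomial is g (1+2t)^K with g fixed. By Pascal's rule its signs are determined by those along the line i ~ 2K/3,
-- where, for K in a residue class modulo 3, the coefficient is a binomial coefficient times a rational function of K,
-- whose sign is read off from a polynomial with nonnegative coefficients.
module Submission where

open import Defs
open import Data.Bool using (Bool; true; false; _∧_; not; if_then_else_) renaming (_≟_ to _≟ᵇ_)
open import Data.Bool.Properties using (T?; ∧-assoc; ∧-zeroʳ)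
open import Data.Empty using (⊥)
open import Data.Fin using (toℕ)
open import Data.Fin.Patterns using (0F; 1F; 2F)
open import Data.Integer using (ℤ; +_; +[1+_]; _+_; _*_; _-_; _≤?_; +≤+; drop‿+≤+; 0ℤ; 1ℤ; -1ℤ; Positive; nonNegative)
  renaming (_≤_ to _≤ᶻ_)
open import Data.Integer.Properties
open import Data.Integer.Tactic.RingSolver using (solve-∀)
open import Data.List using (List; []; _∷_; _++_; map; filter; length; foldr; concatMap; take; drop; upTo; applyUpTo)
open import Data.List.Membership.Propositional.Properties using (∈-upTo⁺)
open import Data.List.Properties using (map-upTo; map-id)
open import Data.List.Relation.Unary.All as All using (All; []; _∷_; all?)
open import Data.Nat as ℕ using (ℕ; zero; suc; _≤_; z≤n; s≤s; _≡ᵇ_)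
open import Data.Nat.DivMod using (_divMod_; result)
import Data.Nat.Properties as ℕₚ
import Data.Nat.Tactic.RingSolver as ℕ-Solver
open import Data.Product using (_×_; _,_; proj₁; proj₂)
open import Data.Sum using (inj₁; inj₂)
open import Data.Vec using (toList; []; _∷_)
open import Function using (_∘_)
open import Relation.Binary.PropositionalEquality
open import Relation.Nullary using (Dec; yes; no; does; contradiction)
open import Relation.Nullary.Decidable using (_×-dec_; from-yes)

-- Coefficient sequences of polynomials; pow c n f stands for (1 + c t)^n f.

Seq : Set
Seq = ℕ → ℤ

lin : ℤ → Seq → Seq
lin c f zero    = f 0
lin c f (suc i) = f (suc i) + c * f i

pow : ℤ → ℕ → Seq → Seq
pow c zero    f = f
pow c (suc n) f = lin c (pow c n f)

lin-cong : ∀ c {f g} → f ≗ g → lin c f ≗ lin c g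
lin-cong c e zero    = e 0
lin-cong c e (suc i) = cong₂ (λ x y → x + c * y) (e (suc i)) (e i)

pow-cong : ∀ c n {f g} → f ≗ g → pow c n f ≗ pow c n g
pow-cong c zero    e = e
pow-cong c (suc n) e = lin-cong c (pow-cong c n e)

lin-comm : ∀ c d f → lin c (lin d f) ≗ lin d (lin c f)
lin-comm c d f zero          = refl
lin-comm c d f (suc zero)    = lemma c d (f 0) (f 1)
  where
  lemma : ∀ c d x y → (y + d * x) + c * x ≡ (y + c * x) + d * x
  lemma = solve-∀
lin-comm c d f (suc (suc i)) = lemma c d (f i) (f (suc i)) (f (suc (suc i)))
  where
  lemma : ∀ c d x y z → (z + d * y) + c * (y + d * x) ≡ (z + c * y) + d * (y + c * x)
  lemma = solve-∀

lin-pow-comm : ∀ c d n f → lin c (pow d n f) ≗ pow d n (lin c f)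
lin-pow-comm c d zero    f i = refl
lin-pow-comm c d (suc n) f i =
  trans (lin-comm c d (pow d n f) i) (lin-cong d (lin-pow-comm c d n f) i)

pow-+ : ∀ c m n f → pow c (m ℕ.+ n) f ≡ pow c m (pow c n f)
pow-+ c zero    n f = refl
pow-+ c (suc m) n f = cong (lin c) (pow-+ c m n f)

lin-linear : ∀ c a f g → lin c (λ i → f i + a * g i) ≗ (λ i → lin c f i + a * lin c g i)
lin-linear c a f g zero    = refl
lin-linear c a f g (suc i) = lemma c a (f i) (g i) (f (suc i)) (g (suc i))
  where
  lemma : ∀ c a x y z w → (z + a * w) + c * (x + a * y) ≡ (z + c * x) + a * (w + c * y)
  lemma = solve-∀

pow-linear : ∀ c a n f g → pow c n (λ i → f i + a * g i) ≗ (λ i → pow c n f i + a * pow c n g i)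
pow-linear c a zero    f g i = refl
pow-linear c a (suc n) f g i =
  trans (lin-cong c (pow-linear c a n f g) i) (lin-linear c a (pow c n f) (pow c n g) i)

pow-scale : ∀ c a n f → pow c n (λ i → a * f i) ≗ (λ i → a * pow c n f i)
pow-scale c a zero    f i       = refl
pow-scale c a (suc n) f zero    = pow-scale c a n f zero
pow-scale c a (suc n) f (suc i) =
  trans (cong₂ (λ x y → x + c * y) (pow-scale c a n f (suc i)) (pow-scale c a n f i))
    (lemma c a (pow c n f (suc i)) (pow c n f i))
  where
  lemma : ∀ c a x y → a * x + c * (a * y) ≡ a * (x + c * y)
  lemma = solve-∀

pow-comm : ∀ c d m n f → pow c m (pow d n f) ≗ pow d n (pow c m f)
pow-comm c d zero    n f i = refl
pow-comm c d (suc m) n f i = trans (lin-cong c (pow-comm c d m n f) i) (lin-pow-comm c d n (pow c m f) i)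

-- Lists of coefficients, lowest degree first.

infixl 6 _⊕_
infixr 7 _⊙_

_⊕_ : List ℤ → List ℤ → List ℤ
[]       ⊕ ys       = ys
(x ∷ xs) ⊕ []       = x ∷ xs
(x ∷ xs) ⊕ (y ∷ ys) = (x + y) ∷ (xs ⊕ ys)

_⊙_ : ℤ → List ℤ → List ℤ
a ⊙ xs = map (a *_) xs

-- (a + b t) xs
affine : ℤ → ℤ → List ℤ → List ℤ
affine a b xs = a ⊙ xs ⊕ (0ℤ ∷ b ⊙ xs)

coef : List ℤ → Seq
coef []       _       = 0ℤ
coef (x ∷ xs) zero    = x
coef (x ∷ xs) (suc i) = coef xs i

eval : List ℤ → ℤ → ℤ
eval []       p = 0ℤ
eval (x ∷ xs) p = x + p * eval xs p

coef-⊕ : ∀ xs ys i → coef (xs ⊕ ys) i ≡ coef xs i + coef ys i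
coef-⊕ []       ys       i       = sym (+-identityˡ _)
coef-⊕ (x ∷ xs) []       i       = sym (+-identityʳ _)
coef-⊕ (x ∷ xs) (y ∷ ys) zero    = refl
coef-⊕ (x ∷ xs) (y ∷ ys) (suc i) = coef-⊕ xs ys i

coef-⊙ : ∀ a xs i → coef (a ⊙ xs) i ≡ a * coef xs i
coef-⊙ a []       i       = sym (*-zeroʳ a)
coef-⊙ a (x ∷ xs) zero    = refl
coef-⊙ a (x ∷ xs) (suc i) = coef-⊙ a xs i

coef-affine : ∀ c xs → coef (affine 1ℤ c xs) ≗ lin c (coef xs)
coef-affine c xs zero    = trans (coef-⊕ (1ℤ ⊙ xs) (0ℤ ∷ c ⊙ xs) 0)
  (trans (+-identityʳ _) (trans (coef-⊙ 1ℤ xs 0) (*-identityˡ _)))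
coef-affine c xs (suc i) = trans (coef-⊕ (1ℤ ⊙ xs) (0ℤ ∷ c ⊙ xs) (suc i))
  (cong₂ _+_ (trans (coef-⊙ 1ℤ xs (suc i)) (*-identityˡ _)) (coef-⊙ c xs i))

eval-⊕ : ∀ xs ys p → eval (xs ⊕ ys) p ≡ eval xs p + eval ys p
eval-⊕ []       ys       p = sym (+-identityˡ _)
eval-⊕ (x ∷ xs) []       p = sym (+-identityʳ _)
eval-⊕ (x ∷ xs) (y ∷ ys) p =
  trans (cong (λ z → x + y + p * z) (eval-⊕ xs ys p)) (lemma x y p (eval xs p) (eval ys p))
  where
  lemma : ∀ x y p a b → x + y + p * (a + b) ≡ (x + p * a) + (y + p * b)
  lemma = solve-∀

eval-⊙ : ∀ a xs p → eval (a ⊙ xs) p ≡ a * eval xs p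
eval-⊙ a []       p = sym (*-zeroʳ a)
eval-⊙ a (x ∷ xs) p = trans (cong (λ z → a * x + p * z) (eval-⊙ a xs p)) (lemma a x p (eval xs p))
  where
  lemma : ∀ a x p e → a * x + p * (a * e) ≡ a * (x + p * e)
  lemma = solve-∀

eval-affine : ∀ a b xs p → eval (affine a b xs) p ≡ (a + p * b) * eval xs p
eval-affine a b xs p = trans (eval-⊕ (a ⊙ xs) (0ℤ ∷ b ⊙ xs) p)
  (trans (cong₂ (λ y z → y + (0ℤ + p * z)) (eval-⊙ a xs p) (eval-⊙ b xs p)) (lemma a b p (eval xs p)))
  where
  lemma : ∀ a b p e → a * e + (0ℤ + p * (b * e)) ≡ (a + p * b) * e
  lemma = solve-∀

-- For a numeral exponent and a closed list this evaluates to a closed list, so the signs of its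
-- entries can be decided by computation.
powL : ℤ → ℕ → List ℤ → List ℤ
powL c zero    xs = xs
powL c (suc n) xs = affine 1ℤ c (powL c n xs)

coef-powL : ∀ c n xs → coef (powL c n xs) ≗ pow c n (coef xs)
coef-powL c zero    xs i = refl
coef-powL c (suc n) xs i =
  trans (coef-affine c (powL c n xs) i) (lin-cong c (coef-powL c n xs) i)

-- For a fixed gap `d` between the exponents, both terms merge into one fixed polynomial times (1 +
-- c t)^K, to which a sign criterion for a single polynomial applies.
pow-powL-⊕ : ∀ c K d g e i →
  pow c K (coef (powL c d g ⊕ e)) i ≡ pow c (K ℕ.+ d) (coef g) i + pow c K (coef e) i
pow-powL-⊕ c K d g e i = begin
  pow c K (coef (powL c d g ⊕ e)) i
    ≡⟨ pow-cong c K (λ j → trans (coef-⊕ (powL c d g) e j)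
         (cong₂ _+_ (coef-powL c d g j) (sym (*-identityˡ _)))) i ⟩
  pow c K (λ j → pow c d (coef g) j + 1ℤ * coef e j) i
    ≡⟨ pow-linear c 1ℤ K (pow c d (coef g)) (coef e) i ⟩
  pow c K (pow c d (coef g)) i + 1ℤ * pow c K (coef e) i
    ≡⟨ cong₂ _+_ (cong (λ f → f i) (sym (pow-+ c K d (coef g)))) (*-identityˡ _) ⟩
  pow c (K ℕ.+ d) (coef g) i + pow c K (coef e) i ∎
  where open ≡-Reasoning

pow-⊙ : ∀ c a n xs → pow c n (coef (a ⊙ xs)) ≗ (λ i → a * pow c n (coef xs) i)
pow-⊙ c a n xs i = trans (pow-cong c n (coef-⊙ a xs) i) (pow-scale c a n (coef xs) i)

-- Coefficients of g (1 + 2t)^N along a line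

binom : ℕ → Seq
binom N = pow (+ 2) N (coef (1ℤ ∷ []))

binom-nonneg : ∀ N i → 0ℤ ≤ᶻ binom N i
binom-nonneg zero    zero    = from-yes (0ℤ ≤? 1ℤ)
binom-nonneg zero    (suc i) = ≤-refl
binom-nonneg (suc N) zero    = binom-nonneg N 0
binom-nonneg (suc N) (suc i) =
  +-mono-≤ (binom-nonneg N (suc i)) (*-monoˡ-≤-nonNeg (+ 2) (binom-nonneg N i))

-- The ratio of consecutive coefficients of (1 + 2t)^N, cleared of its denominator. Subtraction in ℤ
-- keeps it valid for k ≥ N, where both sides vanish.
binom-suc : ∀ N k → + suc k * binom N (suc k) ≡ + 2 * (+ N - + k) * binom N k
binom-suc zero    zero    = refl
binom-suc zero    (suc k) = trans (*-zeroʳ (+ suc (suc k))) (sym (*-zeroʳ (+ 2 * (+ 0 - + suc k))))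
binom-suc (suc N) zero    = trans (lem₁ (binom N 1) (binom N 0))
  (trans (cong (_+ + 2 * binom N 0) (binom-suc N 0)) (lem₂ (+ N) (binom N 0)))
  where
  lem₁ : ∀ x y → + 1 * (x + + 2 * y) ≡ + 1 * x + + 2 * y
  lem₁ = solve-∀
  lem₂ : ∀ n y → + 2 * (n - + 0) * y + + 2 * y ≡ + 2 * ((+ 1 + n) - + 0) * y
  lem₂ = solve-∀
binom-suc (suc N) (suc k) = begin
  s * (z + + 2 * y)                             ≡⟨ lem₁ s z y ⟩
  s * z + + 2 * s * y                           ≡⟨ cong (_+ + 2 * s * y) (binom-suc N (suc k)) ⟩
  + 2 * (+ N - + suc k) * y + + 2 * s * y       ≡⟨ lem₂ (+ N) (+ k) y ⟩
  + 2 * (+ N - + k) * y + + 2 * (+ suc k * y)   ≡⟨ cong (λ v → + 2 * (+ N - + k) * y + + 2 * v) (binom-suc N k) ⟩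
  + 2 * (+ N - + k) * y + + 2 * (+ 2 * (+ N - + k) * x) ≡⟨ lem₃ (+ N) (+ k) x y ⟩
  + 2 * (+ suc N - + suc k) * (y + + 2 * x) ∎
  where
  open ≡-Reasoning
  s = + suc (suc k)
  x = binom N k
  y = binom N (suc k)
  z = binom N (suc (suc k))
  lem₁ : ∀ s z y → s * (z + + 2 * y) ≡ s * z + + 2 * s * y
  lem₁ = solve-∀
  lem₂ : ∀ n k y → + 2 * (n - (+ 1 + k)) * y + + 2 * (+ 2 + k) * y ≡ + 2 * (n - k) * y + + 2 * ((+ 1 + k) * y)
  lem₂ = solve-∀
  lem₃ : ∀ n k x y → + 2 * (n - k) * y + + 2 * (+ 2 * (n - k) * x) ≡ + 2 * ((+ 1 + n) - (+ 1 + k)) * (y + + 2 * x)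
  lem₃ = solve-∀

pow-[] : ∀ c N i → pow c N (coef []) i ≡ 0ℤ
pow-[] c zero    i       = refl
pow-[] c (suc N) zero    = pow-[] c N 0
pow-[] c (suc N) (suc i) = trans (cong₂ (λ x y → x + c * y) (pow-[] c N (suc i)) (pow-[] c N i))
  (trans (+-identityˡ _) (*-zeroʳ c))

pow-∷-zero : ∀ N x xs → pow (+ 2) N (coef (x ∷ xs)) 0 ≡ x * binom N 0
pow-∷-zero zero    x xs = sym (*-identityʳ x)
pow-∷-zero (suc N) x xs = pow-∷-zero N x xs

pow-∷-suc : ∀ N x xs i →
  pow (+ 2) N (coef (x ∷ xs)) (suc i) ≡ x * binom N (suc i) + pow (+ 2) N (coef xs) i
pow-∷-suc zero    x xs i       = sym (trans (cong (_+ coef xs i) (*-zeroʳ x)) (+-identityˡ _))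
pow-∷-suc (suc N) x xs zero    =
  trans (cong₂ (λ a b → a + + 2 * b) (pow-∷-suc N x xs 0) (pow-∷-zero N x xs))
    (lemma x (binom N 1) (binom N 0) (pow (+ 2) N (coef xs) 0))
  where
  lemma : ∀ x b a y → x * b + y + + 2 * (x * a) ≡ x * (b + + 2 * a) + y
  lemma = solve-∀
pow-∷-suc (suc N) x xs (suc i) =
  trans (cong₂ (λ a b → a + + 2 * b) (pow-∷-suc N x xs (suc i)) (pow-∷-suc N x xs i))
    (lemma x (binom N (suc (suc i))) (binom N (suc i)) (pow (+ 2) N (coef xs) (suc i)) (pow (+ 2) N (coef xs) i))
  where
  lemma : ∀ x b a y z → x * b + y + + 2 * (x * a + z) ≡ x * (b + + 2 * a) + (y + + 2 * z)
  lemma = solve-∀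

pow-singleton : ∀ N x i → pow (+ 2) N (coef (x ∷ [])) i ≡ x * binom N i
pow-singleton N x zero    = pow-∷-zero N x []
pow-singleton N x (suc i) =
  trans (pow-∷-suc N x [] i) (trans (cong (λ z → x * binom N (suc i) + z) (pow-[] (+ 2) N i)) (+-identityʳ _))

rising : ℕ → ℕ → ℤ
rising l zero    = 1ℤ
rising l (suc w) = + suc (w ℕ.+ l) * rising l w

-- When N - l = e + p, this is the product of 2 (N - l - j) over j < w, as a polynomial in p.
fallingP : ℤ → ℕ → List ℤ
fallingP e zero    = 1ℤ ∷ []
fallingP e (suc w) = affine (+ 2 * (e - + w)) (+ 2) (fallingP e w)

-- With l = l₀ + 2p and N = l + e + p, all of binom N l, …, binom N (l + w) are, up to the common factor
-- binom N l / rising l w, polynomials in p; this is the resulting polynomial for the coefficient of g (1 + 2t)^N.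
hornerP : ℤ → ℕ → List ℤ → List ℤ
hornerP e l₀ []       = []
hornerP e l₀ (x ∷ xs) = x ⊙ fallingP e (length xs) ⊕ affine (+ (length xs ℕ.+ l₀)) (+ 2) (hornerP e l₀ xs)

module _ (N l l₀ p : ℕ) (e : ℤ) (l≡ : + l ≡ + l₀ + + p * + 2) (N≡ : + N ≡ + l + (e + + p)) where

  rising-binom : ∀ w → rising l w * binom N (w ℕ.+ l) ≡ binom N l * eval (fallingP e w) (+ p)
  rising-binom zero    = trans (*-identityˡ _)
    (sym (trans (cong (λ z → binom N l * (1ℤ + z)) (*-zeroʳ (+ p))) (*-identityʳ _)))
  rising-binom (suc w) = begin
    + suc (w ℕ.+ l) * R * binom N (suc (w ℕ.+ l))   ≡⟨ lem₁ (+ suc (w ℕ.+ l)) R _ ⟩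
    R * (+ suc (w ℕ.+ l) * binom N (suc (w ℕ.+ l))) ≡⟨ cong (R *_) (binom-suc N (w ℕ.+ l)) ⟩
    R * (+ 2 * (+ N - + (w ℕ.+ l)) * β)             ≡⟨ cong (λ n → R * (+ 2 * (n - + (w ℕ.+ l)) * β)) N≡ ⟩
    R * (+ 2 * (+ l + (e + + p) - (+ w + + l)) * β) ≡⟨ lem₂ R (+ l) e (+ p) (+ w) β ⟩
    (+ 2 * (e - + w) + + p * + 2) * (R * β)         ≡⟨ cong ((+ 2 * (e - + w) + + p * + 2) *_) (rising-binom w) ⟩
    (+ 2 * (e - + w) + + p * + 2) * (binom N l * φ) ≡⟨ lem₃ (+ 2 * (e - + w) + + p * + 2) (binom N l) φ ⟩
    binom N l * ((+ 2 * (e - + w) + + p * + 2) * φ)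
      ≡⟨ cong (binom N l *_) (sym (eval-affine (+ 2 * (e - + w)) (+ 2) (fallingP e w) (+ p))) ⟩
    binom N l * eval (fallingP e (suc w)) (+ p) ∎
    where
    open ≡-Reasoning
    R = rising l w
    β = binom N (w ℕ.+ l)
    φ = eval (fallingP e w) (+ p)
    lem₁ : ∀ a b c → a * b * c ≡ b * (a * c)
    lem₁ = solve-∀
    lem₂ : ∀ R l e p w β → R * (+ 2 * (l + (e + p) - (w + l)) * β) ≡ (+ 2 * (e - w) + p * + 2) * (R * β)
    lem₂ = solve-∀
    lem₃ : ∀ a b c → a * (b * c) ≡ b * (a * c)
    lem₃ = solve-∀

  -- A Horner scheme: `x` meets the highest binomial coefficient, which `rising-binom` reduces to
  -- `binom N l`. The tail is the same problem one index lower, multiplied by the new factor of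
  -- `rising`, which is linear in p because l = l₀ + 2p.
  rising-pow : ∀ x xs →
    rising l (length xs) * pow (+ 2) N (coef (x ∷ xs)) (length xs ℕ.+ l)
      ≡ binom N l * eval (hornerP e l₀ (x ∷ xs)) (+ p)
  rising-pow x [] = begin
    1ℤ * pow (+ 2) N (coef (x ∷ [])) l ≡⟨ cong (1ℤ *_) (pow-singleton N x l) ⟩
    1ℤ * (x * binom N l)               ≡⟨ lemma x (binom N l) (+ p) ⟩
    binom N l * ((x * 1ℤ + 0ℤ) + + p * 0ℤ) ∎
    where
    open ≡-Reasoning
    lemma : ∀ x b p → 1ℤ * (x * b) ≡ b * ((x * 1ℤ + 0ℤ) + p * 0ℤ)
    lemma = solve-∀
  rising-pow x xs@(y ∷ ys) = begin
    S * R * pow (+ 2) N (coef (x ∷ xs)) (suc (w ℕ.+ l))    ≡⟨ cong (S * R *_) (pow-∷-suc N x xs (w ℕ.+ l)) ⟩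
    S * R * (x * binom N (suc (w ℕ.+ l)) + c)              ≡⟨ lem₁ S R x _ c ⟩
    x * (S * R * binom N (suc (w ℕ.+ l))) + S * (R * c)
      ≡⟨ cong₂ (λ a b → x * a + S * b) (rising-binom (suc w)) (rising-pow y ys) ⟩
    x * (b * F) + (+ suc w + + l) * (b * H)                ≡⟨ cong (λ z → x * (b * F) + (+ suc w + z) * (b * H)) l≡ ⟩
    x * (b * F) + (+ suc w + (+ l₀ + + p * + 2)) * (b * H) ≡⟨ lem₂ x b F (+ suc w) (+ l₀) (+ p) H ⟩
    b * (x * F + (+ suc w + + l₀ + + p * + 2) * H)
      ≡⟨ cong (b *_) (sym (trans (eval-⊕ (x ⊙ fP) (affine (+ suc w + + l₀) (+ 2) hP) (+ p))
           (cong₂ _+_ (eval-⊙ x fP (+ p)) (eval-affine (+ suc w + + l₀) (+ 2) hP (+ p))))) ⟩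
    b * eval (hornerP e l₀ (x ∷ xs)) (+ p) ∎
    where
    open ≡-Reasoning
    w = length ys
    S = + suc (w ℕ.+ l)
    R = rising l w
    b = binom N l
    c = pow (+ 2) N (coef xs) (w ℕ.+ l)
    fP = fallingP e (suc w)
    hP = hornerP e l₀ xs
    F = eval fP (+ p)
    H = eval hP (+ p)
    lem₁ : ∀ S R x b c → S * R * (x * b + c) ≡ x * (S * R * b) + S * (R * c)
    lem₁ = solve-∀
    lem₂ : ∀ x b F w l p H → x * (b * F) + (w + (l + p * + 2)) * (b * H) ≡ b * (x * F + (w + l + p * + 2) * H)
    lem₂ = solve-∀

-- Sign certificates along the lines N = 3p + r, i = 2p + τ

NonNeg : List ℤ → Set
NonNeg = All (0ℤ ≤ᶻ_)

nonNeg? : ∀ xs → Dec (NonNeg xs)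
nonNeg? = all? (0ℤ ≤?_)

*-nonNeg : ∀ {x y} → 0ℤ ≤ᶻ x → 0ℤ ≤ᶻ y → 0ℤ ≤ᶻ x * y
*-nonNeg {x} {y} 0≤x 0≤y =
  subst (_≤ᶻ x * y) (*-zeroʳ x) (*-monoˡ-≤-nonNeg x {{nonNegative 0≤x}} 0≤y)

eval-nonNeg : ∀ {xs} p → NonNeg xs → 0ℤ ≤ᶻ eval xs (+ p)
eval-nonNeg p []         = ≤-refl
eval-nonNeg p (0≤x ∷ ps) = +-mono-≤ 0≤x (*-nonNeg {+ p} (+≤+ z≤n) (eval-nonNeg p ps))

rising-positive : ∀ l w → Positive (rising l w)
rising-positive l zero    = _
rising-positive l (suc w) = lemma (w ℕ.+ l) (rising l w) (rising-positive l w)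
  where
  lemma : ∀ k j → Positive j → Positive (+ suc k * j)
  lemma k +[1+ n ] _ = _

-- The lowest binomial index involved is 2p + τ - `length xs`; the bound on `length xs` keeps it a
-- natural number for every p.
AsymptoticCert : List ℤ → ℕ → ℕ → Set
AsymptoticCert []       τ r = ⊥
AsymptoticCert (x ∷ xs) τ r =
  length xs ≤ τ × NonNeg (hornerP (+ r - + (τ ℕ.∸ length xs)) (τ ℕ.∸ length xs) (x ∷ xs))

asymptoticCert? : ∀ g τ r → Dec (AsymptoticCert g τ r)
asymptoticCert? []       τ r = no λ ()
asymptoticCert? (x ∷ xs) τ r = (length xs ℕ.≤? τ) ×-dec nonNeg? _

-- By `rising-pow`, a positive multiple of the coefficient equals a binomial coefficient times the
-- certified polynomial at p; the positive factor cancels.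
asymptotic : ∀ g τ r → AsymptoticCert g τ r → ∀ p → 0ℤ ≤ᶻ pow (+ 2) (p ℕ.* 3 ℕ.+ r) (coef g) (p ℕ.* 2 ℕ.+ τ)
asymptotic (x ∷ xs) τ r (w≤τ , pos) p =
  *-cancelˡ-≤-pos 0ℤ _ (rising l w) {{rising-positive l w}}
    (subst₂ _≤ᶻ_ (sym (*-zeroʳ (rising l w)))
      (trans (sym (rising-pow N l l₀ p e l≡ N≡ x xs)) (cong (λ i → rising l w * pow (+ 2) N (coef (x ∷ xs)) i) i≡))
      (*-nonNeg (binom-nonneg N l) (eval-nonNeg p pos)))
  where
  w = length xs
  l₀ = τ ℕ.∸ w
  l = p ℕ.* 2 ℕ.+ l₀
  N = p ℕ.* 3 ℕ.+ r
  e = + r - + l₀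
  l≡ : + l ≡ + l₀ + + p * + 2
  l≡ = trans (cong (_+ + l₀) (pos-* p 2)) (+-comm (+ p * + 2) (+ l₀))
  N≡ : + N ≡ + l + (e + + p)
  N≡ = trans (cong (_+ + r) (pos-* p 3)) (trans (lemma (+ p) (+ r) (+ l₀)) (cong (_+ (e + + p)) (sym l≡)))
    where
    lemma : ∀ p r l → p * + 3 + r ≡ (l + p * + 2) + ((r - l) + p)
    lemma = solve-∀
  i≡ : w ℕ.+ l ≡ p ℕ.* 2 ℕ.+ τ
  i≡ = begin
    w ℕ.+ (p ℕ.* 2 ℕ.+ l₀) ≡⟨ ℕₚ.+-comm w _ ⟩
    p ℕ.* 2 ℕ.+ l₀ ℕ.+ w   ≡⟨ ℕₚ.+-assoc (p ℕ.* 2) l₀ w ⟩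
    p ℕ.* 2 ℕ.+ (l₀ ℕ.+ w) ≡⟨ cong (p ℕ.* 2 ℕ.+_) (ℕₚ.m∸n+n≡m w≤τ) ⟩
    p ℕ.* 2 ℕ.+ τ ∎
    where open ≡-Reasoning

-- Propagation of signs from a line of slope 2/3

module Threshold
  (T : ℕ → ℕ)
  (T-period : ∀ K → T (3 ℕ.+ K) ≡ 2 ℕ.+ T K)
  (T-mono   : ∀ K → T K ≤ T (suc K))
  (T-slow   : ∀ K → T (suc K) ≤ suc (T K))
  where

  -- For K < 9 the lowest coefficient of (1 + 2t)^K involved may have negative index.
  LineCert : List ℤ → Set
  LineCert g =
      All (λ K → 0ℤ ≤ᶻ pow (+ 2) K (coef g) (T K)) (upTo 9)
    × All (λ r → AsymptoticCert g (T r) r) (9 ∷ 10 ∷ 11 ∷ [])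

  lineCert? : ∀ g → Dec (LineCert g)
  lineCert? g = all? (λ K → 0ℤ ≤? _) _ ×-dec all? (λ r → asymptoticCert? g (T r) r) _

  T-line : ∀ p r → T (p ℕ.* 3 ℕ.+ r) ≡ p ℕ.* 2 ℕ.+ T r
  T-line zero    r = refl
  T-line (suc p) r = trans (T-period (p ℕ.* 3 ℕ.+ r)) (cong (2 ℕ.+_) (T-line p r))

  module _ {g : List ℤ} (cert : LineCert g) where

    line-progression : ∀ r → AsymptoticCert g (T r) r →
      ∀ p → 0ℤ ≤ᶻ pow (+ 2) (p ℕ.* 3 ℕ.+ r) (coef g) (T (p ℕ.* 3 ℕ.+ r))
    line-progression r c p rewrite T-line p r = asymptotic g (T r) r c p

    -- From 9 on, K = 3p + r with r among 9, 10, 11, and periodicity gives `T K` = 2p + `T r`, the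
    -- line of `asymptotic`.
    line : ∀ K → 0ℤ ≤ᶻ pow (+ 2) K (coef g) (T K)
    line K with K ℕ.<? 9
    ... | yes K<9 = All.lookup (proj₁ cert) (∈-upTo⁺ K<9)
    ... | no  K≮9 with (K ℕ.∸ 9) divMod 3 | proj₂ cert
    ... | result p r eq | c₀ ∷ c₁ ∷ c₂ ∷ [] =
      subst (λ k → 0ℤ ≤ᶻ pow (+ 2) k (coef g) (T k)) (sym K≡) (step r)
      where
      K≡ : K ≡ p ℕ.* 3 ℕ.+ (9 ℕ.+ toℕ r)
      K≡ = begin
        K                                  ≡⟨ sym (ℕₚ.m+[n∸m]≡n (ℕₚ.≮⇒≥ K≮9)) ⟩
        9 ℕ.+ (K ℕ.∸ 9)                    ≡⟨ cong (9 ℕ.+_) eq ⟩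
        9 ℕ.+ (toℕ r ℕ.+ p ℕ.* 3)          ≡⟨ sym (ℕₚ.+-assoc 9 (toℕ r) (p ℕ.* 3)) ⟩
        (9 ℕ.+ toℕ r) ℕ.+ p ℕ.* 3          ≡⟨ ℕₚ.+-comm (9 ℕ.+ toℕ r) (p ℕ.* 3) ⟩
        p ℕ.* 3 ℕ.+ (9 ℕ.+ toℕ r) ∎
        where open ≡-Reasoning
      step : ∀ r → 0ℤ ≤ᶻ pow (+ 2) (p ℕ.* 3 ℕ.+ (9 ℕ.+ toℕ r)) (coef g) (T (p ℕ.* 3 ℕ.+ (9 ℕ.+ toℕ r)))
      step 0F = line-progression 9  c₀ p
      step 1F = line-progression 10 c₁ p
      step 2F = line-progression 11 c₂ p

  lin-nonNeg : ∀ f i → 0ℤ ≤ᶻ f (suc i) → 0ℤ ≤ᶻ f i → 0ℤ ≤ᶻ lin (+ 2) f (suc i)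
  lin-nonNeg f i p q = +-mono-≤ p (*-monoˡ-≤-nonNeg (+ 2) q)

  BelowCert AboveCert : List ℤ → Set
  BelowCert g = NonNeg (take (suc (T 0)) g) × LineCert g
  AboveCert g = NonNeg (drop (T 0) g) × LineCert g

  belowCert? : ∀ g → Dec (BelowCert g)
  belowCert? g = nonNeg? _ ×-dec lineCert? g

  aboveCert? : ∀ g → Dec (AboveCert g)
  aboveCert? g = nonNeg? _ ×-dec lineCert? g

  coef-take : ∀ g n i → NonNeg (take (suc n) g) → i ≤ n → 0ℤ ≤ᶻ coef g i
  coef-take []      n       i       ps       i≤n       = ≤-refl
  coef-take (x ∷ g) n       zero    (p ∷ ps) i≤n       = p
  coef-take (x ∷ g) (suc n) (suc i) (p ∷ ps) (s≤s i≤n) = coef-take g n i ps i≤n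

  coef-drop : ∀ g n i → NonNeg (drop n g) → n ≤ i → 0ℤ ≤ᶻ coef g i
  coef-drop []      n       i       ps       n≤i       = ≤-refl
  coef-drop (x ∷ g) zero    zero    (p ∷ ps) n≤i       = p
  coef-drop (x ∷ g) zero    (suc i) (p ∷ ps) n≤i       = coef-drop g 0 i ps z≤n
  coef-drop (x ∷ g) (suc n) (suc i) ps       (s≤s n≤i) = coef-drop g n i ps n≤i

  -- Pascal's rule. Strictly below the threshold, `T-slow` keeps both parents in the region for K.
  -- On the threshold the parent with the same index may lie outside, and `line` takes over.
  nonNeg-below : ∀ {g} → BelowCert g → ∀ K i → i ≤ T K → 0ℤ ≤ᶻ pow (+ 2) K (coef g) i
  nonNeg-below {g} (base , _) zero    i       i≤T = coef-take g (T 0) i base i≤T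
  nonNeg-below {g} c          (suc K) zero    i≤T = nonNeg-below c K zero z≤n
  nonNeg-below {g} c          (suc K) (suc i) i≤T with ℕₚ.m≤n⇒m<n∨m≡n i≤T
  ... | inj₂ i≡T = subst (λ k → 0ℤ ≤ᶻ pow (+ 2) (suc K) (coef g) k) (sym i≡T) (line (proj₂ c) (suc K))
  ... | inj₁ i<T = lin-nonNeg (pow (+ 2) K (coef g)) i
    (nonNeg-below c K (suc i) i<T′) (nonNeg-below c K i (ℕₚ.≤-trans (ℕₚ.n≤1+n i) i<T′))
    where
    i<T′ : suc i ≤ T K
    i<T′ = ℕ.s≤s⁻¹ (ℕₚ.≤-trans i<T (T-slow K))

  -- The mirror image: past the threshold `T-mono` keeps both parents in the region, and on it the
  -- parent with the smaller index may fall out.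
  nonNeg-above : ∀ {g} → AboveCert g → ∀ K i → T K ≤ i → 0ℤ ≤ᶻ pow (+ 2) K (coef g) i
  nonNeg-above {g} (base , _) zero    i       T≤i = coef-drop g (T 0) i base T≤i
  nonNeg-above {g} c          (suc K) zero    T≤i = nonNeg-above c K zero (ℕₚ.≤-trans (T-mono K) T≤i)
  nonNeg-above {g} c          (suc K) (suc i) T≤i with ℕₚ.m≤n⇒m<n∨m≡n T≤i
  ... | inj₂ T≡i = subst (λ k → 0ℤ ≤ᶻ pow (+ 2) (suc K) (coef g) k) T≡i (line (proj₂ c) (suc K))
  ... | inj₁ T<i = lin-nonNeg (pow (+ 2) K (coef g)) i
    (nonNeg-above c K (suc i) (ℕₚ.≤-trans (T-mono K) T≤i))
    (nonNeg-above c K i (ℕₚ.≤-trans (T-mono K) (ℕ.s≤s⁻¹ T<i)))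

-- Sums of g (1 + 2t)^N and e (1 + 2t)^K

-- The peak of g (1 + 2t)^N moves by 2/3 when N increases by 1.
peak : ℕ → ℕ
peak 0                   = 3
peak 1                   = 3
peak 2                   = 4
peak (suc (suc (suc N))) = 2 ℕ.+ peak N

peak-suc : ∀ N → peak N ≤ peak (suc N)
peak-suc 0                   = ℕₚ.≤-refl
peak-suc 1                   = ℕₚ.n≤1+n 3
peak-suc 2                   = ℕₚ.n≤1+n 4
peak-suc (suc (suc (suc N))) = ℕₚ.+-monoʳ-≤ 2 (peak-suc N)

peak-slow : ∀ N → peak (suc N) ≤ suc (peak N)
peak-slow 0                   = ℕₚ.n≤1+n 3
peak-slow 1                   = ℕₚ.≤-refl
peak-slow 2                   = ℕₚ.≤-refl
peak-slow (suc (suc (suc N))) = ℕₚ.+-monoʳ-≤ 2 (peak-slow N)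

peak-mono : ∀ d N → peak N ≤ peak (d ℕ.+ N)
peak-mono zero    N = ℕₚ.≤-refl
peak-mono (suc d) N = ℕₚ.≤-trans (peak-mono d N) (peak-suc (d ℕ.+ N))

-- `c` is the offset past the peak and `d` a shift of the exponent, so that thresholds in terms of N
-- = K + d can be used for multiples of (1 + 2t)^K.
module Line (c d : ℕ) = Threshold (λ K → c ℕ.+ peak (K ℕ.+ d))
  (λ K → trans (ℕₚ.+-suc c _) (cong suc (ℕₚ.+-suc c _)))
  (λ K → ℕₚ.+-monoʳ-≤ c (peak-suc (K ℕ.+ d)))
  (λ K → ℕₚ.≤-trans (ℕₚ.+-monoʳ-≤ c (peak-slow (K ℕ.+ d))) (ℕₚ.≤-reflexive (ℕₚ.+-suc c _)))

neg : List ℤ → List ℤ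
neg xs = -1ℤ ⊙ xs

nonPos-above : ∀ c d {g} → Line.AboveCert c d (neg g) →
  ∀ K i → c ℕ.+ peak (K ℕ.+ d) ≤ i → pow (+ 2) K (coef g) i ≤ᶻ 0ℤ
nonPos-above c d {g} cert K i T≤i = neg-cancel-≤ (subst (0ℤ ≤ᶻ_)
  (trans (pow-⊙ (+ 2) -1ℤ K g i) (-1*i≡-i _))
  (Line.nonNeg-above c d {neg g} cert K i T≤i))

-- The gaps N - K = `suc d` checked outright are 1 to 6 below the peak and 1, 2 above it. The third
-- entry makes e (1 + 2t)^K nonpositive from 3 + peak (K + 1) = peak (K + 7) - 1 on, which settles
-- all larger gaps.
PerturbationCert : List ℤ → List ℤ → Set
PerturbationCert g e =
    Line.BelowCert 0 0 g
  × Line.AboveCert 2 0 (neg g)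
  × Line.AboveCert 3 1 (neg e)
  × All (λ d → Line.BelowCert 0 (suc d) (powL (+ 2) (suc d) g ⊕ e)) (upTo 6)
  × All (λ d → Line.AboveCert 2 (suc d) (neg (powL (+ 2) (suc d) g ⊕ e))) (upTo 2)

perturbationCert? : ∀ g e → Dec (PerturbationCert g e)
perturbationCert? g e =
        Line.belowCert? 0 0 g
  ×-dec Line.aboveCert? 2 0 (neg g)
  ×-dec Line.aboveCert? 3 1 (neg e)
  ×-dec all? (λ d → Line.belowCert? 0 (suc d) (powL (+ 2) (suc d) g ⊕ e)) (upTo 6)
  ×-dec all? (λ d → Line.aboveCert? 2 (suc d) (neg (powL (+ 2) (suc d) g ⊕ e))) (upTo 2)

-- If N - K > 6, then either i ≤ peak (N - 1), and lowering N does not increase the i-th coefficient of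
-- g (1 + 2t)^N + e (1 + 2t)^K, or that of e (1 + 2t)^K is already nonpositive at i - 1, and raising K does not
-- increase it.
module Perturbation (g e : List ℤ) (cert : PerturbationCert g e) where

  private
    g-below    = proj₁ cert
    g-above    = proj₁ (proj₂ cert)
    e-above    = proj₁ (proj₂ (proj₂ cert))
    near-below = proj₁ (proj₂ (proj₂ (proj₂ cert)))
    near-above = proj₂ (proj₂ (proj₂ (proj₂ cert)))

  q γ : ℕ → Seq
  q N = pow (+ 2) N (coef g)
  γ K = pow (+ 2) K (coef e)

  q≥0 : ∀ N i → i ≤ peak N → 0ℤ ≤ᶻ q N i
  q≥0 N i i≤J = Line.nonNeg-below 0 0 {g} g-below N i (subst (λ n → i ≤ peak n) (sym (ℕₚ.+-identityʳ N)) i≤J)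

  q≤0 : ∀ N i → 2 ℕ.+ peak N ≤ i → q N i ≤ᶻ 0ℤ
  q≤0 N i J≤i = nonPos-above 2 0 {g} g-above N i (subst (λ n → 2 ℕ.+ peak n ≤ i) (sym (ℕₚ.+-identityʳ N)) J≤i)

  γ≤0 : ∀ K i → 3 ℕ.+ peak (suc K) ≤ i → γ K i ≤ᶻ 0ℤ
  γ≤0 K i J≤i = nonPos-above 3 1 {e} e-above K i (subst (λ n → 3 ℕ.+ peak n ≤ i) (ℕₚ.+-comm 1 K) J≤i)

  below : ∀ d K i → i ≤ peak (suc d ℕ.+ K) → 0ℤ ≤ᶻ q (suc d ℕ.+ K) i + γ K i
  below d K i i≤J with d ℕ.<? 6
  ... | yes d<6 = subst (λ n → 0ℤ ≤ᶻ q n i + γ K i) (ℕₚ.+-comm K (suc d))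
    (subst (0ℤ ≤ᶻ_) (pow-powL-⊕ (+ 2) K (suc d) g e i)
      (Line.nonNeg-below 0 (suc d) {powL (+ 2) (suc d) g ⊕ e} (All.lookup near-below (∈-upTo⁺ d<6)) K i
        (subst (λ n → i ≤ peak n) (ℕₚ.+-comm (suc d) K) i≤J)))
  below zero    K i i≤J | no d≮6 = contradiction (s≤s z≤n) d≮6
  below (suc d) K i i≤J | no d≮6 with i ℕ.≤? peak (6 ℕ.+ K)
  ... | no i≰J = ≤-trans
    (subst (λ n → 0ℤ ≤ᶻ q n i + γ (suc K) i) N≡ (below d (suc K) i (subst (λ n → i ≤ peak n) (sym N≡) i≤J)))
    (+-monoʳ-≤ (q (suc (suc d) ℕ.+ K) i) (descend i (ℕₚ.≤-trans (peak-slow (6 ℕ.+ K)) (ℕₚ.≰⇒> i≰J))))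
    where
    N≡ : suc d ℕ.+ suc K ≡ suc (suc d) ℕ.+ K
    N≡ = cong suc (ℕₚ.+-suc d K)
    descend : ∀ i → peak (7 ℕ.+ K) ≤ i → γ (suc K) i ≤ᶻ γ K i
    -- `peak (7 + K)` reduces to 4 + `peak (1 + K)`, so the index `i`, one lower, is just within
    -- reach of `γ≤0`.
    descend (suc i) J≤i = ≤-trans
      (+-monoʳ-≤ (γ K (suc i)) (*-monoˡ-≤-nonNeg (+ 2) (γ≤0 K i (ℕ.s≤s⁻¹ J≤i))))
      (≤-reflexive (+-identityʳ _))
  ... | yes i≤J′ = ≤-trans (below d K i (ℕₚ.≤-trans i≤J′ J≤)) (+-monoˡ-≤ (γ K i) (ascend i (ℕₚ.≤-trans i≤J′ J≤)))
    where
    -- Here N - 1 is `suc d + K`, and `suc d` is at least 6.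
    J≤ : peak (6 ℕ.+ K) ≤ peak (suc d ℕ.+ K)
    J≤ = subst (λ n → peak (6 ℕ.+ K) ≤ peak n)
           (trans (sym (ℕₚ.+-assoc (suc d ℕ.∸ 6) 6 K)) (cong (ℕ._+ K) (ℕₚ.m∸n+n≡m (ℕₚ.≮⇒≥ d≮6))))
           (peak-mono (suc d ℕ.∸ 6) (6 ℕ.+ K))
    ascend : ∀ i → i ≤ peak (suc d ℕ.+ K) → q (suc d ℕ.+ K) i ≤ᶻ q (suc (suc d) ℕ.+ K) i
    ascend zero    i≤J = ≤-refl
    ascend (suc i) i<J = ≤-trans (≤-reflexive (sym (+-identityʳ _)))
      (+-monoʳ-≤ (q (suc d ℕ.+ K) (suc i))
        (*-monoˡ-≤-nonNeg (+ 2) (q≥0 (suc d ℕ.+ K) i (ℕₚ.≤-trans (ℕₚ.n≤1+n i) i<J))))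

  above : ∀ d K i → 2 ℕ.+ peak (suc d ℕ.+ K) ≤ i → q (suc d ℕ.+ K) i + γ K i ≤ᶻ 0ℤ
  above d K i J≤i with d ℕ.<? 2
  ... | yes d<2 = subst (λ n → q n i + γ K i ≤ᶻ 0ℤ) (ℕₚ.+-comm K (suc d))
    (subst (_≤ᶻ 0ℤ) (pow-powL-⊕ (+ 2) K (suc d) g e i)
      (nonPos-above 2 (suc d) {powL (+ 2) (suc d) g ⊕ e} (All.lookup near-above (∈-upTo⁺ d<2)) K i
        (subst (λ n → 2 ℕ.+ peak n ≤ i) (ℕₚ.+-comm (suc d) K) J≤i)))
  -- For a gap of at least 3 both terms are nonpositive separately: 1 + peak (K + 1) ≤ 2 + peak K =
  -- peak (K + 3) ≤ peak N.
  ... | no d≮2 = +-mono-≤ (q≤0 (suc d ℕ.+ K) i J≤i) (γ≤0 K i (ℕₚ.≤-trans (ℕₚ.+-monoʳ-≤ 2 J<) J≤i))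
    where
    J< : suc (peak (suc K)) ≤ peak (suc d ℕ.+ K)
    J< = ℕₚ.≤-trans (s≤s (peak-slow K)) (subst (λ n → peak (3 ℕ.+ K) ≤ peak (suc n))
           (trans (sym (ℕₚ.+-assoc (d ℕ.∸ 2) 2 K)) (cong (ℕ._+ K) (ℕₚ.m∸n+n≡m (ℕₚ.≮⇒≥ d≮2))))
           (subst (λ n → peak (3 ℕ.+ K) ≤ peak n) (ℕₚ.+-suc (d ℕ.∸ 2) (2 ℕ.+ K)) (peak-mono (d ℕ.∸ 2) (3 ℕ.+ K))))

  private
    gap : ∀ {K N} → K ℕ.< N → suc (N ℕ.∸ suc K) ℕ.+ K ≡ N
    gap {K} {N} K<N = trans (sym (ℕₚ.+-suc (N ℕ.∸ suc K) K)) (ℕₚ.m∸n+n≡m K<N)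

  nonNeg-perturbed : ∀ {K N i} → K ℕ.< N → i ≤ peak N → 0ℤ ≤ᶻ q N i + γ K i
  nonNeg-perturbed {K} {N} {i} K<N i≤ = subst (λ M → 0ℤ ≤ᶻ q M i + γ K i) (gap K<N)
    (below (N ℕ.∸ suc K) K i (subst (λ M → i ≤ peak M) (sym (gap K<N)) i≤))

  nonPos-perturbed : ∀ {K N i} → K ℕ.< N → 2 ℕ.+ peak N ≤ i → q N i + γ K i ≤ᶻ 0ℤ
  nonPos-perturbed {K} {N} {i} K<N ≤i = subst (λ M → q M i + γ K i ≤ᶻ 0ℤ) (gap K<N)
    (above (N ℕ.∸ suc K) K i (subst (λ M → 2 ℕ.+ peak M ≤ i) (sym (gap K<N)) ≤i))

-- The polynomials of the tree and their certificates

-- For m = n = 0 these count the independent sets containing neither of v₂ and v₃, a prescribed one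
-- only, or both.
Q B tB : List ℤ
Q  = + 1 ∷ + 10 ∷ + 36 ∷ + 59 ∷ + 45 ∷ + 13 ∷ []
B  = + 0 ∷ + 1 ∷ + 9 ∷ + 28 ∷ + 36 ∷ + 17 ∷ + 1 ∷ []
tB = + 0 ∷ B

Δ : List ℤ → List ℤ
Δ = affine 1ℤ -1ℤ

-- The coefficients come from 6 I = (Q u^N + 6 B u^m s^n) + (Q u^N + 6 B s^m u^n) + 2 (2 Q u^N + 3 t B s^N), where
-- u = 1 + 2t and s = 1 + t. One factor s is kept in e₁ and e₂, leaving u^K with K < N: already
-- 2 Q u^N + 3 t B u^N has the wrong signs past the peak.
dQ e₁ e₂ : List ℤ
dQ = Δ Q
e₁ = + 6 ⊙ Δ (affine 1ℤ 1ℤ B)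
e₂ = + 3 ⊙ Δ (affine 1ℤ 1ℤ tB)

-- The certificates are decided by evaluation. `P₁` handles the terms with exactly one of v₂ and v₃
-- chosen, `P₂` the term with both.
module P₁ = Perturbation dQ e₁ (from-yes (perturbationCert? dQ e₁))
module P₂ = Perturbation (+ 2 ⊙ dQ) e₂ (from-yes (perturbationCert? (+ 2 ⊙ dQ) e₂))

∧-swap : ∀ x y z → x ∧ (y ∧ z) ≡ y ∧ (x ∧ z)
∧-swap true  y z = refl
∧-swap false y z = sym (∧-zeroʳ y)

-- Weighted sums over all Boolean lists of a given length

Weight : Set
Weight = ℕ → ℤ

Z : ℕ → (List Bool → Bool) → Weight → ℤ
Z zero    Ψ w = if Ψ [] then w 0 else 0ℤ
Z (suc n) Ψ w = Z n (Ψ ∘ (true ∷_)) (w ∘ suc) + Z n (Ψ ∘ (false ∷_)) w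

Z-cong : ∀ n {Ψ Φ} w → Ψ ≗ Φ → Z n Ψ w ≡ Z n Φ w
Z-cong zero    w e = cong (λ b → if b then w 0 else 0ℤ) (e [])
Z-cong (suc n) w e = cong₂ _+_ (Z-cong n (w ∘ suc) (e ∘ (true ∷_))) (Z-cong n w (e ∘ (false ∷_)))

Z-false : ∀ n w → Z n (λ _ → false) w ≡ 0ℤ
Z-false zero    w = refl
Z-false (suc n) w = cong₂ _+_ (Z-false n (w ∘ suc)) (Z-false n w)

Z-linear : ∀ n Ψ c w v → Z n Ψ (λ s → w s + c * v s) ≡ Z n Ψ w + c * Z n Ψ v
Z-linear zero    Ψ c w v with Ψ []
... | true  = refl
... | false = sym (trans (+-identityˡ _) (*-zeroʳ c))
Z-linear (suc n) Ψ c w v =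
  trans (cong₂ _+_ (Z-linear n (Ψ ∘ (true ∷_)) c (w ∘ suc) (v ∘ suc)) (Z-linear n (Ψ ∘ (false ∷_)) c w v))
    (lemma c (Z n (Ψ ∘ (true ∷_)) (w ∘ suc)) (Z n (Ψ ∘ (true ∷_)) (v ∘ suc))
      (Z n (Ψ ∘ (false ∷_)) w) (Z n (Ψ ∘ (false ∷_)) v))
  where
  lemma : ∀ c x y z t → (x + c * y) + (z + c * t) ≡ (x + z) + c * (y + t)
  lemma = solve-∀

Z-split : ∀ n (χ Ψ : List Bool → Bool) w →
  Z n Ψ w ≡ Z n (λ s → does (χ s ≟ᵇ true) ∧ Ψ s) w + Z n (λ s → does (χ s ≟ᵇ false) ∧ Ψ s) w
Z-split zero    χ Ψ w with χ [] | Ψ []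
... | true  | true  = sym (+-identityʳ _)
... | true  | false = refl
... | false | true  = sym (+-identityˡ _)
... | false | false = refl
Z-split (suc n) χ Ψ w =
  trans (cong₂ _+_ (Z-split n (χ ∘ (true ∷_)) (Ψ ∘ (true ∷_)) (w ∘ suc))
                   (Z-split n (χ ∘ (false ∷_)) (Ψ ∘ (false ∷_)) w))
    (lemma (Z n _ (w ∘ suc)) _ _ _)
  where
  lemma : ∀ x y z t → (x + y) + (z + t) ≡ (x + z) + (y + t)
  lemma = solve-∀

-- Multiplication by 1 + c t, seen from the weights.
adjoint : ℤ → Weight → Weight
adjoint c w s = w s + c * w (suc s)

adjointⁿ : ℤ → ℕ → Weight → Weight
adjointⁿ c zero    w = w
adjointⁿ c (suc n) w = adjointⁿ c n (adjoint c w)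

-- A pendant edge hanging from a vertex contributes 1 + t if that vertex is chosen and 1 + 2t otherwise.
pendant : Bool → ℤ
pendant b = if b then + 1 else + 2

-- The vertices at positions k and k + 1 are summed out. Choosing both is forbidden by their edge,
-- and choosing only the first is allowed just when its neighbour, in state `b`, is absent.
Z-pendant : ∀ k L Ψ Φ b w →
  (∀ c p p′ R → length c ≡ k → Ψ (c ++ p ∷ p′ ∷ R) ≡ not (b ∧ p) ∧ not (p ∧ p′) ∧ Φ (c ++ R)) →
  Z (k ℕ.+ (2 ℕ.+ L)) Ψ w ≡ Z (k ℕ.+ L) Φ (adjoint (pendant b) w)
Z-pendant (suc k) L Ψ Φ b w h = cong₂ _+_
  (Z-pendant k L _ _ b (w ∘ suc) (λ c p p′ R → h (true ∷ c) p p′ R ∘ cong suc))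
  (Z-pendant k L _ _ b w (λ c p p′ R → h (false ∷ c) p p′ R ∘ cong suc))
Z-pendant zero L Ψ Φ b w h = trans
  (cong₂ _+_ (cong₂ _+_ (part true true) (part true false)) (cong₂ _+_ (part false true) (part false false)))
  (trans (cases b) (sym (Z-linear L Φ (pendant b) w (w ∘ suc))))
  where
  part : ∀ p p′ {v} → Z L (λ R → Ψ (p ∷ p′ ∷ R)) v ≡ Z L (λ R → not (b ∧ p) ∧ not (p ∧ p′) ∧ Φ R) v
  part p p′ {v} = Z-cong L v (λ R → h [] p p′ R refl)
  lem₁ : ∀ x y → ((0ℤ + 0ℤ) + (x + y)) ≡ y + + 1 * x
  lem₁ = solve-∀
  lem₂ : ∀ x y → ((0ℤ + x) + (x + y)) ≡ y + + 2 * x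
  lem₂ = solve-∀
  cases : ∀ b →
    (Z L (λ R → not (b ∧ true) ∧ not true ∧ Φ R) (w ∘ suc ∘ suc)
      + Z L (λ R → not (b ∧ true) ∧ not false ∧ Φ R) (w ∘ suc))
    + (Z L (λ R → not (b ∧ false) ∧ not false ∧ Φ R) (w ∘ suc)
      + Z L (λ R → not (b ∧ false) ∧ not false ∧ Φ R) w)
    ≡ Z L Φ w + pendant b * Z L Φ (w ∘ suc)
  cases true  = trans (cong₂ (λ x y → (x + y) + (Z L Φ (w ∘ suc) + Z L Φ w)) (Z-false L _) (Z-false L _))
    (lem₁ (Z L Φ (w ∘ suc)) (Z L Φ w))
  cases false = trans (cong (λ x → (x + Z L Φ (w ∘ suc)) + (Z L Φ (w ∘ suc) + Z L Φ w)) (Z-false L _))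
    (lem₂ (Z L Φ (w ∘ suc)) (Z L Φ w))

-- Pairing of polynomials with weights

dot : List ℤ → Weight → ℤ
dot []       w = 0ℤ
dot (x ∷ xs) w = x * w 0 + dot xs (w ∘ suc)

dot-⊕ : ∀ xs ys w → dot (xs ⊕ ys) w ≡ dot xs w + dot ys w
dot-⊕ []       ys       w = sym (+-identityˡ _)
dot-⊕ (x ∷ xs) []       w = sym (+-identityʳ _)
dot-⊕ (x ∷ xs) (y ∷ ys) w = trans (cong (λ d → (x + y) * w 0 + d) (dot-⊕ xs ys (w ∘ suc))) (lemma x y (w 0) _ _)
  where
  lemma : ∀ x y z a b → (x + y) * z + (a + b) ≡ (x * z + a) + (y * z + b)
  lemma = solve-∀

dot-⊙ : ∀ a xs w → dot (a ⊙ xs) w ≡ a * dot xs w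
dot-⊙ a []       w = sym (*-zeroʳ a)
dot-⊙ a (x ∷ xs) w = trans (cong (λ d → a * x * w 0 + d) (dot-⊙ a xs (w ∘ suc))) (lemma a x (w 0) _)
  where
  lemma : ∀ a x z d → a * x * z + a * d ≡ a * (x * z + d)
  lemma = solve-∀

dot-adjoint : ∀ c xs w → dot xs (adjoint c w) ≡ dot xs w + c * dot xs (w ∘ suc)
dot-adjoint c []       w = sym (trans (+-identityˡ _) (*-zeroʳ c))
dot-adjoint c (x ∷ xs) w = trans (cong (λ d → x * (w 0 + c * w 1) + d) (dot-adjoint c xs (w ∘ suc)))
  (lemma c x (w 0) (w 1) _ _)
  where
  lemma : ∀ c x w v a b → x * (w + c * v) + (a + c * b) ≡ (x * w + a) + c * (x * v + b)
  lemma = solve-∀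

-- Under the pairing, `adjoint c` is the transpose of multiplication by 1 + c t; the weight `δ k`
-- then reads off a coefficient.
dot-affine : ∀ c xs w → dot xs (adjoint c w) ≡ dot (affine 1ℤ c xs) w
dot-affine c xs w = sym (begin
  dot (1ℤ ⊙ xs ⊕ (0ℤ ∷ c ⊙ xs)) w
    ≡⟨ dot-⊕ (1ℤ ⊙ xs) (0ℤ ∷ c ⊙ xs) w ⟩
  dot (1ℤ ⊙ xs) w + (0ℤ + dot (c ⊙ xs) (w ∘ suc))
    ≡⟨ cong₂ _+_ (trans (dot-⊙ 1ℤ xs w) (*-identityˡ _)) (trans (+-identityˡ _) (dot-⊙ c xs (w ∘ suc))) ⟩
  dot xs w + c * dot xs (w ∘ suc)
    ≡⟨ sym (dot-adjoint c xs w) ⟩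
  dot xs (adjoint c w) ∎)
  where open ≡-Reasoning

dot-adjointⁿ : ∀ c n xs w → dot xs (adjointⁿ c n w) ≡ dot (powL c n xs) w
dot-adjointⁿ c zero    xs w = refl
dot-adjointⁿ c (suc n) xs w = trans (dot-adjointⁿ c n xs (adjoint c w)) (dot-affine c (powL c n xs) w)

δ : ℕ → Weight
δ k s = if s ≡ᵇ k then 1ℤ else 0ℤ

dot-0 : ∀ xs → dot xs (λ _ → 0ℤ) ≡ 0ℤ
dot-0 []       = refl
dot-0 (x ∷ xs) = cong₂ _+_ (*-zeroʳ x) (dot-0 xs)

dot-δ : ∀ xs k → dot xs (δ k) ≡ coef xs k
dot-δ []       k       = refl
dot-δ (x ∷ xs) zero    = trans (cong₂ _+_ (*-identityʳ x) (dot-0 xs)) (+-identityʳ x)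
dot-δ (x ∷ xs) (suc k) = trans (cong₂ _+_ (*-zeroʳ x) (dot-δ xs k)) (+-identityˡ _)

-- Keeping [] fixed avoids trailing zeros in genPoly, so that genPoly 12 (Restricted b₂ b₃ 0 0) computes to Q, B or tB.
shift : List ℤ → List ℤ
shift []       = []
shift (x ∷ xs) = 0ℤ ∷ x ∷ xs

dot-shift : ∀ xs w → dot (shift xs) w ≡ dot xs (w ∘ suc)
dot-shift []       w = refl
dot-shift (x ∷ xs) w = +-identityˡ _

genPoly : ℕ → (List Bool → Bool) → List ℤ
genPoly zero    Ψ = if Ψ [] then 1ℤ ∷ [] else []
genPoly (suc n) Ψ = shift (genPoly n (Ψ ∘ (true ∷_))) ⊕ genPoly n (Ψ ∘ (false ∷_))

Z-genPoly : ∀ n Ψ w → Z n Ψ w ≡ dot (genPoly n Ψ) w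
Z-genPoly zero    Ψ w with Ψ []
... | true  = sym (trans (+-identityʳ _) (*-identityˡ _))
... | false = refl
Z-genPoly (suc n) Ψ w = begin
  Z n _ (w ∘ suc) + Z n _ w                           ≡⟨ cong₂ _+_ (Z-genPoly n _ (w ∘ suc)) (Z-genPoly n _ w) ⟩
  dot G₁ (w ∘ suc) + dot G₀ w                         ≡⟨ cong (_+ dot G₀ w) (sym (dot-shift G₁ w)) ⟩
  dot (shift G₁) w + dot G₀ w                         ≡⟨ sym (dot-⊕ (shift G₁) G₀ w) ⟩
  dot (shift G₁ ⊕ G₀) w ∎
  where
  open ≡-Reasoning
  G₁ = genPoly n (Ψ ∘ (true ∷_))
  G₀ = genPoly n (Ψ ∘ (false ∷_))

-- Independent sets as Boolean lists

-- The nested filters copy the shape of `indepCount`, which is thereby an instance by definition.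
count : ∀ {A : Set} (p q : A → Bool) → List A → ℕ
count p q xs = length (filter (λ x → T? (p x)) (filter (λ x → T? (q x)) xs))

count-++ : ∀ {A : Set} (p q : A → Bool) xs ys → count p q (xs ++ ys) ≡ count p q xs ℕ.+ count p q ys
count-++ p q []       ys = refl
count-++ p q (x ∷ xs) ys with q x
... | false = count-++ p q xs ys
... | true with p x
...   | false = count-++ p q xs ys
...   | true  = cong suc (count-++ p q xs ys)

count-map : ∀ {A B : Set} (p q : B → Bool) (f : A → B) xs → count p q (map f xs) ≡ count (p ∘ f) (q ∘ f) xs
count-map p q f []       = refl
count-map p q f (x ∷ xs) with q (f x)
... | false = count-map p q f xs
... | true with p (f x)
...   | false = count-map p q f xs
...   | true  = cong suc (count-map p q f xs)

count-allSubsets : ∀ n (χ : ℕ → Bool) (q : Subset n → Bool) Ψ → (∀ S → q S ≡ Ψ (toList S)) →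
  + count (χ ∘ size) q (allSubsets n) ≡ Z n Ψ (λ s → if χ s then 1ℤ else 0ℤ)
count-allSubsets zero χ q Ψ h rewrite h [] with Ψ []
... | false = refl
... | true with χ 0
...   | false = refl
...   | true  = refl
count-allSubsets (suc n) χ q Ψ h = begin
  + count (χ ∘ size) q (map (true ∷_) S ++ map (false ∷_) S)
    ≡⟨ cong +_ (count-++ (χ ∘ size) q (map (true ∷_) S) (map (false ∷_) S)) ⟩
  + count (χ ∘ size) q (map (true ∷_) S) + + count (χ ∘ size) q (map (false ∷_) S)
    ≡⟨ cong₂ (λ a b → + a + + b) (count-map (χ ∘ size) q (true ∷_) S) (count-map (χ ∘ size) q (false ∷_) S) ⟩
  + count (χ ∘ suc ∘ size) (q ∘ (true ∷_)) S + + count (χ ∘ size) (q ∘ (false ∷_)) S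
    ≡⟨ cong₂ _+_ (count-allSubsets n (χ ∘ suc) _ _ (h ∘ (true ∷_))) (count-allSubsets n χ _ _ (h ∘ (false ∷_))) ⟩
  Z (suc n) Ψ (λ s → if χ s then 1ℤ else 0ℤ) ∎
  where
  open ≡-Reasoning
  S = allSubsets n

-- Plain lists, unlike `Subset n`, let two entries be deleted from the middle without transport
-- along length equations.
elem : List Bool → ℕ → Bool
elem []      _       = false
elem (b ∷ _) zero    = b
elem (_ ∷ s) (suc i) = elem s i

mem-toList : ∀ {n} (S : Subset n) i → mem S i ≡ elem (toList S) i
mem-toList []      i       = refl
mem-toList (b ∷ S) zero    = refl
mem-toList (b ∷ S) (suc i) = mem-toList S i

noEdge : (ℕ → Bool) → List (ℕ × ℕ) → Bool
noEdge f = foldr (λ e acc → not (f (proj₁ e) ∧ f (proj₂ e)) ∧ acc) true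

noEdge-cong : ∀ {f g} es → f ≗ g → noEdge f es ≡ noEdge g es
noEdge-cong []             e = refl
noEdge-cong ((u , v) ∷ es) e = cong₂ _∧_ (cong₂ (λ x y → not (x ∧ y)) (e u) (e v)) (noEdge-cong es e)

noEdge-++ : ∀ f es es′ → noEdge f (es ++ es′) ≡ noEdge f es ∧ noEdge f es′
noEdge-++ f []       es′ = refl
noEdge-++ f (e ∷ es) es′ = trans (cong (ok ∧_) (noEdge-++ f es es′)) (sym (∧-assoc ok (noEdge f es) (noEdge f es′)))
  where ok = not (f (proj₁ e) ∧ f (proj₂ e))

indepCount-Z : ∀ G k → + indepCount G k ≡ Z (V G) (λ s → noEdge (elem s) (E G)) (δ k)
indepCount-Z G k = count-allSubsets (V G) (_≡ᵇ k) (independent G) _ (λ S → noEdge-cong (E G) (mem-toList S))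

-- Deleting one pendant edge from the edge list

pair : ℕ → ℕ → ℕ → List (ℕ × ℕ)
pair c o j = (c , o ℕ.+ 2 ℕ.* j) ∷ (o ℕ.+ 2 ℕ.* j , o ℕ.+ 2 ℕ.* j ℕ.+ 1) ∷ []

-- Two uses determine the generality: `h` = `suc` drops the first pendant edge of a branch, and the
-- identity moves the offset of a branch.
noEdge-pairs : ∀ f g c o o′ js js′ → f c ≡ g c → (h : ℕ → ℕ) → js ≡ map h js′ →
  (∀ j i → f (o ℕ.+ 2 ℕ.* h j ℕ.+ i) ≡ g (o′ ℕ.+ 2 ℕ.* j ℕ.+ i)) →
  noEdge f (concatMap (pair c o) js) ≡ noEdge g (concatMap (pair c o′) js′)
noEdge-pairs f g c o o′ _ []         fc h refl e = refl
noEdge-pairs f g c o o′ _ (j ∷ js′) fc h refl e =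
  cong₂ _∧_ (cong₂ (λ x y → not (x ∧ y)) fc e₀)
    (cong₂ _∧_ (cong₂ (λ x y → not (x ∧ y)) e₀ (e j 1)) (noEdge-pairs f g c o o′ _ js′ fc h refl e))
  where
  e₀ : f (o ℕ.+ 2 ℕ.* h j) ≡ g (o′ ℕ.+ 2 ℕ.* j)
  e₀ = subst₂ (λ a b → f a ≡ g b) (ℕₚ.+-identityʳ _) (ℕₚ.+-identityʳ _) (e j 0)

module _ (f g : ℕ → Bool) (shifted : ∀ i → f (12 ℕ.+ i) ≡ g (10 ℕ.+ i)) where

  noEdge-branch-suc : ∀ c k → f c ≡ g c →
    noEdge f (branch c 10 (suc k)) ≡ not (f c ∧ f 10) ∧ not (f 10 ∧ f 11) ∧ noEdge g (branch c 10 k)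
  noEdge-branch-suc c k fc = cong (λ b → not (f c ∧ f 10) ∧ not (f 10 ∧ f 11) ∧ b)
    (noEdge-pairs f g c 10 10 (applyUpTo suc k) (upTo k) fc suc (sym (map-upTo suc k))
      (λ j i → trans (cong f (index j i)) (shifted (2 ℕ.* j ℕ.+ i))))
    where
    index : ∀ j i → 10 ℕ.+ 2 ℕ.* suc j ℕ.+ i ≡ 12 ℕ.+ (2 ℕ.* j ℕ.+ i)
    index = ℕ-Solver.solve-∀

  noEdge-branch-shift : ∀ c m k → f c ≡ g c →
    noEdge f (branch c (10 ℕ.+ 2 ℕ.* suc m) k) ≡ noEdge g (branch c (10 ℕ.+ 2 ℕ.* m) k)
  noEdge-branch-shift c m k fc =
    noEdge-pairs f g c (10 ℕ.+ 2 ℕ.* suc m) (10 ℕ.+ 2 ℕ.* m) (upTo k) (upTo k) fc (λ j → j) (sym (map-id (upTo k)))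
      (λ j i → trans (cong f (index m j i)) (shifted (2 ℕ.* m ℕ.+ 2 ℕ.* j ℕ.+ i)))
    where
    index : ∀ m j i → 10 ℕ.+ 2 ℕ.* suc m ℕ.+ 2 ℕ.* j ℕ.+ i ≡ 12 ℕ.+ (2 ℕ.* m ℕ.+ 2 ℕ.* j ℕ.+ i)
    index = ℕ-Solver.solve-∀

-- The edges of Tstar m n outside the branches at v₂ and v₃, where x is the vertex number 10 + l.
trunk : ℕ → List (ℕ × ℕ)
trunk l = (0 , 1) ∷ (0 , 2) ∷ (0 , 3) ∷ (9 , 10 ℕ.+ l) ∷ (10 ℕ.+ l , 11 ℕ.+ l) ∷ branch 1 4 3

noEdge-Tstar : ∀ {m n} h → noEdge h (E (Tstar m n)) ≡
  noEdge h (trunk (2 ℕ.* m ℕ.+ 2 ℕ.* n)) ∧ noEdge h (branch 2 10 m) ∧ noEdge h (branch 3 (10 ℕ.+ 2 ℕ.* m) n)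
noEdge-Tstar {m} {n} h = trans
  (noEdge-++ h (trunk (2 ℕ.* m ℕ.+ 2 ℕ.* n)) (branch 2 10 m ++ branch 3 (10 ℕ.+ 2 ℕ.* m) n))
  (cong (noEdge h (trunk (2 ℕ.* m ℕ.+ 2 ℕ.* n)) ∧_) (noEdge-++ h (branch 2 10 m) (branch 3 (10 ℕ.+ 2 ℕ.* m) n)))

2<10 : 2 ℕ.< 10
2<10 = from-yes (2 ℕ.<? 10)

3<10 : 3 ℕ.< 10
3<10 = from-yes (3 ℕ.<? 10)

-- `c` holds the vertices 0 to 9, and `p`, `p′` are positions 10 and 11: the first pendant edge at
-- v₂, or at v₃ once m = 0. `f` and `g` are membership before and after deletion.
module _ (c R : List Bool) (p p′ : Bool) (|c| : length c ≡ 10) where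

  private
    f g : ℕ → Bool
    f = elem (c ++ p ∷ p′ ∷ R)
    g = elem (c ++ R)

  shifted : ∀ i → f (12 ℕ.+ i) ≡ g (10 ℕ.+ i)
  shifted = lemma c |c|
    where
    lemma : ∀ c → length c ≡ 10 → ∀ i → elem (c ++ p ∷ p′ ∷ R) (12 ℕ.+ i) ≡ elem (c ++ R) (10 ℕ.+ i)
    -- Ten explicit entries let `elem` compute past the prefix.
    lemma (_ ∷ _ ∷ _ ∷ _ ∷ _ ∷ _ ∷ _ ∷ _ ∷ _ ∷ _ ∷ []) refl i = refl

  noEdge-trunk : ∀ {l l′} → l ≡ 2 ℕ.+ l′ → noEdge f (trunk l) ≡ noEdge g (trunk l′)
  noEdge-trunk {l′ = l} refl = lemma c |c|
    where
    lemma : ∀ c → length c ≡ 10 → noEdge (elem (c ++ p ∷ p′ ∷ R)) (trunk (2 ℕ.+ l)) ≡ noEdge (elem (c ++ R)) (trunk l)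
    lemma (_ ∷ _ ∷ _ ∷ _ ∷ _ ∷ _ ∷ _ ∷ _ ∷ _ ∷ _ ∷ []) refl = refl

  core : ∀ i → i ℕ.< 10 → elem (c ++ p ∷ p′ ∷ R) i ≡ elem (c ++ R) i
  core i i<10 = lemma c i (subst (i ℕ.<_) (sym |c|) i<10)
    where
    lemma : ∀ c i → i ℕ.< length c → elem (c ++ p ∷ p′ ∷ R) i ≡ elem (c ++ R) i
    lemma (b ∷ c) zero    i<       = refl
    lemma (b ∷ c) (suc i) (s≤s i<) = lemma c i i<

  pair₀ : f 10 ≡ p
  pair₀ = lemma c |c|
    where
    lemma : ∀ c → length c ≡ 10 → elem (c ++ p ∷ p′ ∷ R) 10 ≡ p
    lemma (_ ∷ _ ∷ _ ∷ _ ∷ _ ∷ _ ∷ _ ∷ _ ∷ _ ∷ _ ∷ []) refl = refl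

  pair₁ : f 11 ≡ p′
  pair₁ = lemma c |c|
    where
    lemma : ∀ c → length c ≡ 10 → elem (c ++ p ∷ p′ ∷ R) 11 ≡ p′
    lemma (_ ∷ _ ∷ _ ∷ _ ∷ _ ∷ _ ∷ _ ∷ _ ∷ _ ∷ _ ∷ []) refl = refl

  branch-suc : ∀ v k → v ℕ.< 10 →
    noEdge f (branch v 10 (suc k)) ≡ not (g v ∧ p) ∧ not (p ∧ p′) ∧ noEdge g (branch v 10 k)
  branch-suc v k v<10 = trans (noEdge-branch-suc f g shifted v k (core v v<10))
    (trans (cong (λ x → not (x ∧ f 10) ∧ not (f 10 ∧ f 11) ∧ β) (core v v<10))
      (cong₂ (λ x y → not (g v ∧ x) ∧ not (x ∧ y) ∧ β) pair₀ pair₁))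
    where β = noEdge g (branch v 10 k)

  -- The branch at v₂ loses its first pendant edge, while the branch at v₃ and the vertices x, y
  -- move down by two numbers.
  Tstar-sucˡ : ∀ m n → noEdge f (E (Tstar (suc m) n)) ≡ not (g 2 ∧ p) ∧ not (p ∧ p′) ∧ noEdge g (E (Tstar m n))
  Tstar-sucˡ m n = begin
    noEdge f (E (Tstar (suc m) n)) ≡⟨ noEdge-Tstar {suc m} {n} f ⟩
    noEdge f (trunk (2 ℕ.* suc m ℕ.+ 2 ℕ.* n)) ∧ noEdge f (branch 2 10 (suc m))
      ∧ noEdge f (branch 3 (10 ℕ.+ 2 ℕ.* suc m) n)
      ≡⟨ cong₂ _∧_ (noEdge-trunk (index m n)) (cong₂ _∧_ (branch-suc 2 m 2<10)
           (noEdge-branch-shift f g shifted 3 m n (core 3 3<10))) ⟩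
    t ∧ ((x ∧ y ∧ b₂) ∧ b₃)        ≡⟨ lemma t x y b₂ b₃ ⟩
    x ∧ y ∧ (t ∧ b₂ ∧ b₃)          ≡⟨ cong (λ z → x ∧ y ∧ z) (sym (noEdge-Tstar {m} {n} g)) ⟩
    x ∧ y ∧ noEdge g (E (Tstar m n)) ∎
    where
    open ≡-Reasoning
    index : ∀ m n → 2 ℕ.* suc m ℕ.+ 2 ℕ.* n ≡ 2 ℕ.+ (2 ℕ.* m ℕ.+ 2 ℕ.* n)
    index = ℕ-Solver.solve-∀
    t = noEdge g (trunk (2 ℕ.* m ℕ.+ 2 ℕ.* n))
    x = not (g 2 ∧ p)
    y = not (p ∧ p′)
    b₂ = noEdge g (branch 2 10 m)
    b₃ = noEdge g (branch 3 (10 ℕ.+ 2 ℕ.* m) n)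
    lemma : ∀ t x y b c → t ∧ ((x ∧ y ∧ b) ∧ c) ≡ x ∧ y ∧ (t ∧ b ∧ c)
    lemma t true  true  b c = refl
    lemma t true  false b c = ∧-zeroʳ t
    lemma t false y     b c = ∧-zeroʳ t

  -- With m = 0 the first pendant edge at v₃ occupies positions 10 and 11, hence the branch at v₂ is
  -- emptied first.
  Tstar-sucʳ : ∀ n → noEdge f (E (Tstar 0 (suc n))) ≡ not (g 3 ∧ p) ∧ not (p ∧ p′) ∧ noEdge g (E (Tstar 0 n))
  Tstar-sucʳ n = begin
    noEdge f (E (Tstar 0 (suc n))) ≡⟨ noEdge-Tstar {0} {suc n} f ⟩
    noEdge f (trunk (2 ℕ.* suc n)) ∧ noEdge f (branch 3 10 (suc n))
      ≡⟨ cong₂ _∧_ (noEdge-trunk (ℕₚ.*-suc 2 n)) (branch-suc 3 n 3<10) ⟩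
    t ∧ (x ∧ y ∧ b)                ≡⟨ trans (∧-swap t x (y ∧ b)) (cong (x ∧_) (∧-swap t y b)) ⟩
    x ∧ y ∧ (t ∧ b)                ≡⟨ cong (λ z → x ∧ y ∧ z) (sym (noEdge-Tstar {0} {n} g)) ⟩
    x ∧ y ∧ noEdge g (E (Tstar 0 n)) ∎
    where
    open ≡-Reasoning
    t = noEdge g (trunk (2 ℕ.* n))
    x = not (g 3 ∧ p)
    y = not (p ∧ p′)
    b = noEdge g (branch 3 10 n)

-- Sums with the states of v₂ and v₃ prescribed

Restricted : Bool → Bool → ℕ → ℕ → List Bool → Bool
Restricted b₂ b₃ m n s = does (elem s 2 ≟ᵇ b₂) ∧ does (elem s 3 ≟ᵇ b₃) ∧ noEdge (elem s) (E (Tstar m n))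

-- The guard c = b turns the edge constraint into one with a constant `b`, the form that `Z-pendant`
-- requires.
replace : ∀ c b p y z → does (c ≟ᵇ b) ∧ (not (c ∧ p) ∧ y ∧ z) ≡ not (b ∧ p) ∧ y ∧ (does (c ≟ᵇ b) ∧ z)
replace true  true  p y z = refl
replace false false p y z = refl
replace true  false p y z = sym (∧-zeroʳ y)
replace false true  p y z = sym (trans (cong (not p ∧_) (∧-zeroʳ y)) (∧-zeroʳ (not p)))

replaceˡ : ∀ c d b p y z → does (c ≟ᵇ b) ∧ d ∧ (not (c ∧ p) ∧ y ∧ z) ≡ not (b ∧ p) ∧ y ∧ (does (c ≟ᵇ b) ∧ d ∧ z)
replaceˡ c d b p y z = trans
  (cong (does (c ≟ᵇ b) ∧_) (trans (∧-swap d (not (c ∧ p)) (y ∧ z)) (cong (not (c ∧ p) ∧_) (∧-swap d y z))))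
  (replace c b p y (d ∧ z))

replaceʳ : ∀ c d b p y z → d ∧ does (c ≟ᵇ b) ∧ (not (c ∧ p) ∧ y ∧ z) ≡ not (b ∧ p) ∧ y ∧ (d ∧ does (c ≟ᵇ b) ∧ z)
replaceʳ c d b p y z = trans (cong (d ∧_) (replace c b p y z))
  (trans (∧-swap d (not (b ∧ p)) (y ∧ (does (c ≟ᵇ b) ∧ z))) (cong (not (b ∧ p) ∧_) (∧-swap d y (does (c ≟ᵇ b) ∧ z))))

module _ (b₂ b₃ : Bool) where

  Z-Restricted-m : ∀ m n w →
    Z (12 ℕ.+ 2 ℕ.* m ℕ.+ 2 ℕ.* n) (Restricted b₂ b₃ m n) w
      ≡ Z (12 ℕ.+ 2 ℕ.* n) (Restricted b₂ b₃ 0 n) (adjointⁿ (pendant b₂) m w)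
  Z-Restricted-m zero    n w = refl
  Z-Restricted-m (suc m) n w = begin
    Z (12 ℕ.+ 2 ℕ.* suc m ℕ.+ 2 ℕ.* n) (Restricted b₂ b₃ (suc m) n) w
      ≡⟨ cong (λ L → Z L (Restricted b₂ b₃ (suc m) n) w) (index m n) ⟩
    Z (10 ℕ.+ (2 ℕ.+ (2 ℕ.+ 2 ℕ.* m ℕ.+ 2 ℕ.* n))) (Restricted b₂ b₃ (suc m) n) w
      ≡⟨ Z-pendant 10 (2 ℕ.+ 2 ℕ.* m ℕ.+ 2 ℕ.* n) (Restricted b₂ b₃ (suc m) n) (Restricted b₂ b₃ m n) b₂ w step ⟩
    Z (12 ℕ.+ 2 ℕ.* m ℕ.+ 2 ℕ.* n) (Restricted b₂ b₃ m n) (adjoint (pendant b₂) w)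
      ≡⟨ Z-Restricted-m m n (adjoint (pendant b₂) w) ⟩
    Z (12 ℕ.+ 2 ℕ.* n) (Restricted b₂ b₃ 0 n) (adjointⁿ (pendant b₂) (suc m) w) ∎
    where
    open ≡-Reasoning
    index : ∀ m n → 12 ℕ.+ 2 ℕ.* suc m ℕ.+ 2 ℕ.* n ≡ 14 ℕ.+ 2 ℕ.* m ℕ.+ 2 ℕ.* n
    index = ℕ-Solver.solve-∀
    step : ∀ c p p′ R → length c ≡ 10 →
      Restricted b₂ b₃ (suc m) n (c ++ p ∷ p′ ∷ R) ≡ not (b₂ ∧ p) ∧ not (p ∧ p′) ∧ Restricted b₂ b₃ m n (c ++ R)
    step c p p′ R |c| = trans
      (cong₂ _∧_ (cong (λ x → does (x ≟ᵇ b₂)) (core c R p p′ |c| 2 2<10))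
        (cong₂ _∧_ (cong (λ x → does (x ≟ᵇ b₃)) (core c R p p′ |c| 3 3<10))
          (Tstar-sucˡ c R p p′ |c| m n)))
      (replaceˡ (elem (c ++ R) 2) (does (elem (c ++ R) 3 ≟ᵇ b₃)) b₂ p (not (p ∧ p′))
        (noEdge (elem (c ++ R)) (E (Tstar m n))))

  Z-Restricted-n : ∀ n w →
    Z (12 ℕ.+ 2 ℕ.* n) (Restricted b₂ b₃ 0 n) w ≡ Z 12 (Restricted b₂ b₃ 0 0) (adjointⁿ (pendant b₃) n w)
  Z-Restricted-n zero    w = refl
  Z-Restricted-n (suc n) w = begin
    Z (12 ℕ.+ 2 ℕ.* suc n) (Restricted b₂ b₃ 0 (suc n)) w
      ≡⟨ cong (λ L → Z (12 ℕ.+ L) (Restricted b₂ b₃ 0 (suc n)) w) (ℕₚ.*-suc 2 n) ⟩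
    Z (10 ℕ.+ (2 ℕ.+ (2 ℕ.+ 2 ℕ.* n))) (Restricted b₂ b₃ 0 (suc n)) w
      ≡⟨ Z-pendant 10 (2 ℕ.+ 2 ℕ.* n) (Restricted b₂ b₃ 0 (suc n)) (Restricted b₂ b₃ 0 n) b₃ w step ⟩
    Z (12 ℕ.+ 2 ℕ.* n) (Restricted b₂ b₃ 0 n) (adjoint (pendant b₃) w)
      ≡⟨ Z-Restricted-n n (adjoint (pendant b₃) w) ⟩
    Z 12 (Restricted b₂ b₃ 0 0) (adjointⁿ (pendant b₃) (suc n) w) ∎
    where
    open ≡-Reasoning
    step : ∀ c p p′ R → length c ≡ 10 →
      Restricted b₂ b₃ 0 (suc n) (c ++ p ∷ p′ ∷ R) ≡ not (b₃ ∧ p) ∧ not (p ∧ p′) ∧ Restricted b₂ b₃ 0 n (c ++ R)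
    step c p p′ R |c| = trans
      (cong₂ _∧_ (cong (λ x → does (x ≟ᵇ b₂)) (core c R p p′ |c| 2 2<10))
        (cong₂ _∧_ (cong (λ x → does (x ≟ᵇ b₃)) (core c R p p′ |c| 3 3<10))
          (Tstar-sucʳ c R p p′ |c| n)))
      (replaceʳ (elem (c ++ R) 3) (does (elem (c ++ R) 2 ≟ᵇ b₂)) b₃ p (not (p ∧ p′))
        (noEdge (elem (c ++ R)) (E (Tstar 0 n))))

  Z-Restricted : ∀ m n k →
    Z (12 ℕ.+ 2 ℕ.* m ℕ.+ 2 ℕ.* n) (Restricted b₂ b₃ m n) (δ k)
      ≡ pow (pendant b₂) m (pow (pendant b₃) n (coef (genPoly 12 (Restricted b₂ b₃ 0 0)))) k
  Z-Restricted m n k = begin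
    Z (12 ℕ.+ 2 ℕ.* m ℕ.+ 2 ℕ.* n) (Restricted b₂ b₃ m n) (δ k)
      ≡⟨ Z-Restricted-m m n (δ k) ⟩
    Z (12 ℕ.+ 2 ℕ.* n) (Restricted b₂ b₃ 0 n) wₘ
      ≡⟨ Z-Restricted-n n wₘ ⟩
    Z 12 (Restricted b₂ b₃ 0 0) (adjointⁿ (pendant b₃) n wₘ)
      ≡⟨ Z-genPoly 12 (Restricted b₂ b₃ 0 0) (adjointⁿ (pendant b₃) n wₘ) ⟩
    dot G (adjointⁿ (pendant b₃) n wₘ)
      ≡⟨ dot-adjointⁿ (pendant b₃) n G wₘ ⟩
    dot (powL (pendant b₃) n G) wₘ
      ≡⟨ dot-adjointⁿ (pendant b₂) m (powL (pendant b₃) n G) (δ k) ⟩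
    dot (powL (pendant b₂) m (powL (pendant b₃) n G)) (δ k)
      ≡⟨ dot-δ (powL (pendant b₂) m (powL (pendant b₃) n G)) k ⟩
    coef (powL (pendant b₂) m (powL (pendant b₃) n G)) k
      ≡⟨ coef-powL (pendant b₂) m (powL (pendant b₃) n G) k ⟩
    pow (pendant b₂) m (coef (powL (pendant b₃) n G)) k
      ≡⟨ pow-cong (pendant b₂) m (coef-powL (pendant b₃) n G) k ⟩
    pow (pendant b₂) m (pow (pendant b₃) n (coef G)) k ∎
    where
    open ≡-Reasoning
    wₘ = adjointⁿ (pendant b₂) m (δ k)
    G = genPoly 12 (Restricted b₂ b₃ 0 0)

-- Differences and powers of 1 + t

-- Multiplications commute, so 1 - t and one factor 1 + t can be absorbed into the fixed polynomial,
-- as in `e₁` and `e₂`.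
scaled-Δ : ∀ k b a xs i →
  k * lin -1ℤ (pow 1ℤ (suc b) (pow (+ 2) a (coef xs))) i ≡ pow 1ℤ b (pow (+ 2) a (coef (k ⊙ Δ (affine 1ℤ 1ℤ xs)))) i
scaled-Δ k b a xs i = sym (begin
  pow 1ℤ b (pow (+ 2) a (coef (k ⊙ Δ (affine 1ℤ 1ℤ xs)))) i
    ≡⟨ pow-cong 1ℤ b (pow-⊙ (+ 2) k a (Δ (affine 1ℤ 1ℤ xs))) i ⟩
  pow 1ℤ b (λ j → k * pow (+ 2) a (coef (Δ (affine 1ℤ 1ℤ xs))) j) i
    ≡⟨ pow-scale 1ℤ k b (pow (+ 2) a (coef (Δ (affine 1ℤ 1ℤ xs)))) i ⟩
  k * pow 1ℤ b (pow (+ 2) a (coef (Δ (affine 1ℤ 1ℤ xs)))) i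
    ≡⟨ cong (k *_) (pow-cong 1ℤ b (pow-cong (+ 2) a
         (λ j → trans (coef-affine -1ℤ (affine 1ℤ 1ℤ xs) j) (lin-cong -1ℤ (coef-affine 1ℤ xs) j))) i) ⟩
  k * pow 1ℤ b (pow (+ 2) a (lin -1ℤ (lin 1ℤ (coef xs)))) i
    ≡⟨ cong (k *_) (sym (trans (lin-pow-comm -1ℤ 1ℤ b (lin 1ℤ F) i)
         (pow-cong 1ℤ b (λ j → trans (lin-cong -1ℤ (lin-pow-comm 1ℤ (+ 2) a (coef xs)) j)
           (lin-pow-comm -1ℤ (+ 2) a (lin 1ℤ (coef xs)) j)) i))) ⟩
  k * lin -1ℤ (pow 1ℤ b (lin 1ℤ F)) i
    ≡⟨ cong (k *_) (lin-cong -1ℤ (λ j → sym (lin-pow-comm 1ℤ 1ℤ b F j)) i) ⟩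
  k * lin -1ℤ (pow 1ℤ (suc b) F) i ∎)
  where
  open ≡-Reasoning
  F = pow (+ 2) a (coef xs)

-- 1 + t is the mean of 1 and 1 + 2t, so powers of 1 + t can be traded for means of powers of 1 + 2t.
module Mean (P : ℤ → Set) (mean : ∀ {x y} z → + 2 * z ≡ x + y → P x → P y → P z)
  (f : Seq) (X : ℤ) (i N : ℕ) (h : ∀ a → a ℕ.< N → P (X + pow (+ 2) a f i)) where

  -- Replacing each factor 1 + t by 1 or 1 + 2t yields exponents from a to a + b, so b + a < N keeps
  -- all of them in the range of `h`.
  mixed : ∀ b a → b ℕ.+ a ℕ.< N → P (X + pow 1ℤ b (pow (+ 2) a f) i)
  mixed zero    a a<N = h a a<N
  mixed (suc b) a lt  = mean _ (twice i)
    (mixed b a (ℕₚ.<-trans (ℕₚ.n<1+n (b ℕ.+ a)) lt))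
    (mixed b (suc a) (subst (ℕ._< N) (sym (ℕₚ.+-suc b a)) lt))
    where
    F = pow 1ℤ b (pow (+ 2) a f)
    double : ∀ i → + 2 * (X + lin 1ℤ F i) ≡ (X + F i) + (X + lin (+ 2) F i)
    double zero    = lemma X (F 0)
      where
      lemma : ∀ X x → + 2 * (X + x) ≡ (X + x) + (X + x)
      lemma = solve-∀
    double (suc i) = lemma X (F (suc i)) (F i)
      where
      lemma : ∀ X x y → + 2 * (X + (x + 1ℤ * y)) ≡ (X + x) + (X + (x + + 2 * y))
      lemma = solve-∀
    twice : ∀ i → + 2 * (X + lin 1ℤ F i) ≡ (X + F i) + (X + pow 1ℤ b (pow (+ 2) (suc a) f) i)
    twice i = trans (double i) (cong (λ y → (X + F i) + (X + y)) (lin-pow-comm (+ 2) 1ℤ b (pow (+ 2) a f) i))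

-- The independence polynomial of the tree

-- The factors `1ℤ` give each sum the form to which `lin-linear` applies.
indepCoef : ℕ → ℕ → Seq
indepCoef m n k = (pow (+ 2) m (pow (+ 2) n (coef Q)) k + 1ℤ * pow (+ 1) m (pow (+ 2) n (coef B)) k)
  + 1ℤ * (pow (+ 2) m (pow (+ 1) n (coef B)) k + 1ℤ * pow (+ 1) m (pow (+ 1) n (coef tB)) k)

indepCount-Tstar : ∀ m n k → + indepCount (Tstar m n) k ≡ indepCoef m n k
indepCount-Tstar m n k = begin
  + indepCount (Tstar m n) k ≡⟨ indepCount-Z (Tstar m n) k ⟩
  Z L Ψ (δ k)                ≡⟨ Z-split L (λ s → elem s 3) Ψ (δ k) ⟩
  Z L (λ s → does (elem s 3 ≟ᵇ true) ∧ Ψ s) (δ k) + Z L (λ s → does (elem s 3 ≟ᵇ false) ∧ Ψ s) (δ k)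
    ≡⟨ cong₂ _+_ (Z-split L (λ s → elem s 2) (λ s → does (elem s 3 ≟ᵇ true) ∧ Ψ s) (δ k))
                 (Z-split L (λ s → elem s 2) (λ s → does (elem s 3 ≟ᵇ false) ∧ Ψ s) (δ k)) ⟩
  (R true true + R false true) + (R true false + R false false)
    -- The four core polynomials evaluate to `tB`, `B`, `B` and `Q`, in this order.
    ≡⟨ cong₂ _+_ (cong₂ _+_ (Z-Restricted true true m n k) (Z-Restricted false true m n k))
                 (cong₂ _+_ (Z-Restricted true false m n k) (Z-Restricted false false m n k)) ⟩
  (z + y) + (x + w)          ≡⟨ lemma w x y z ⟩
  indepCoef m n k ∎
  where
  open ≡-Reasoning
  L = 12 ℕ.+ 2 ℕ.* m ℕ.+ 2 ℕ.* n
  Ψ : List Bool → Bool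
  Ψ s = noEdge (elem s) (E (Tstar m n))
  R : Bool → Bool → ℤ
  R b₂ b₃ = Z L (Restricted b₂ b₃ m n) (δ k)
  w = pow (+ 2) m (pow (+ 2) n (coef Q)) k
  x = pow (+ 1) m (pow (+ 2) n (coef B)) k
  y = pow (+ 2) m (pow (+ 1) n (coef B)) k
  z = pow (+ 1) m (pow (+ 1) n (coef tB)) k
  lemma : ∀ w x y z → (z + y) + (x + w) ≡ (w + 1ℤ * x) + 1ℤ * (y + 1ℤ * z)
  lemma = solve-∀

-- Signs of consecutive differences

module _ (m n i : ℕ) where

  private
    N : ℕ
    N = suc m ℕ.+ suc n
    L₁ L₂ L₃ : ℤ
    L₁ = P₁.q N i + pow 1ℤ m (pow (+ 2) (suc n) (coef e₁)) i
    L₂ = P₁.q N i + pow 1ℤ n (pow (+ 2) (suc m) (coef e₁)) i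
    L₃ = P₂.q N i + pow 1ℤ (m ℕ.+ suc n) (pow (+ 2) 0 (coef e₂)) i

  -- This is 1 - t times the splitting of 6 I. Each summand pairs a share of the dominant term with
  -- one other term, whose weight 6 or 3 sits inside `e₁` or `e₂`.
  decomposition : + 6 * lin -1ℤ (indepCoef (suc m) (suc n)) i ≡ (L₁ + L₂) + + 2 * L₃
  decomposition = begin
    + 6 * D (indepCoef (suc m) (suc n))
      ≡⟨ cong (+ 6 *_) (trans (lin-linear -1ℤ 1ℤ (λ k → f k + 1ℤ * g k) (λ k → h k + 1ℤ * l k) i)
           (cong₂ (λ x y → x + 1ℤ * y) (lin-linear -1ℤ 1ℤ f g i) (lin-linear -1ℤ 1ℤ h l i))) ⟩
    + 6 * ((D f + 1ℤ * D g) + 1ℤ * (D h + 1ℤ * D l))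
      ≡⟨ lem (D f) (D g) (D h) (D l) ⟩
    ((D f + + 6 * D g) + (D f + + 6 * D h)) + + 2 * (+ 2 * D f + + 3 * D l)
      ≡⟨ cong₂ (λ x y → x + + 2 * y) (cong₂ _+_ (cong₂ _+_ Df Dg) (cong₂ _+_ Df Dh)) (cong₂ _+_ Df₂ Dl) ⟩
    (L₁ + L₂) + + 2 * L₃ ∎
    where
    open ≡-Reasoning
    D : Seq → ℤ
    D s = lin -1ℤ s i
    f g h l : Seq
    f = pow (+ 2) (suc m) (pow (+ 2) (suc n) (coef Q))
    g = pow (+ 1) (suc m) (pow (+ 2) (suc n) (coef B))
    h = pow (+ 2) (suc m) (pow (+ 1) (suc n) (coef B))
    l = pow (+ 1) (suc m) (pow (+ 1) (suc n) (coef tB))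
    lem : ∀ f g h l → + 6 * ((f + 1ℤ * g) + 1ℤ * (h + 1ℤ * l))
      ≡ ((f + + 6 * g) + (f + + 6 * h)) + + 2 * (+ 2 * f + + 3 * l)
    lem = solve-∀
    Df : D f ≡ P₁.q N i
    Df = trans (cong (λ s → lin -1ℤ s i) (sym (pow-+ (+ 2) (suc m) (suc n) (coef Q))))
      (trans (lin-pow-comm -1ℤ (+ 2) N (coef Q) i) (pow-cong (+ 2) N (λ j → sym (coef-affine -1ℤ Q j)) i))
    Df₂ : + 2 * D f ≡ P₂.q N i
    Df₂ = trans (cong (+ 2 *_) Df) (sym (pow-⊙ (+ 2) (+ 2) N dQ i))
    Dg : + 6 * D g ≡ pow 1ℤ m (pow (+ 2) (suc n) (coef e₁)) i
    Dg = scaled-Δ (+ 6) m (suc n) B i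
    Dh : + 6 * D h ≡ pow 1ℤ n (pow (+ 2) (suc m) (coef e₁)) i
    Dh = trans (cong (+ 6 *_) (lin-cong -1ℤ (pow-comm (+ 2) (+ 1) (suc m) (suc n) (coef B)) i))
      (scaled-Δ (+ 6) n (suc m) B i)
    Dl : + 3 * D l ≡ pow 1ℤ (m ℕ.+ suc n) (pow (+ 2) 0 (coef e₂)) i
    Dl = trans (cong (λ s → + 3 * lin -1ℤ s i) (sym (pow-+ 1ℤ (suc m) (suc n) (coef tB))))
      (scaled-Δ (+ 3) (m ℕ.+ suc n) 0 tB i)

  module _ (P : ℤ → Set) (mean : ∀ {x y} z → + 2 * z ≡ x + y → P x → P y → P z)
    (h₁ : ∀ K → K ℕ.< N → P (P₁.q N i + P₁.γ K i))
    (h₂ : ∀ K → K ℕ.< N → P (P₂.q N i + P₂.γ K i)) where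

    -- `P` is either sign condition. In each of `L₁`, `L₂`, `L₃` the factor 1 + t kept back leaves
    -- exponents with sum N - 1, just within the range of `Mean.mixed`.
    combine : (∀ {x y} → P x → P y → P (x + y)) → P (+ 6 * lin -1ℤ (indepCoef (suc m) (suc n)) i)
    combine add = subst P (sym (trans decomposition (cong (λ z → (L₁ + L₂) + z) (two L₃))))
      (add (add l₁ l₂) (add l₃ l₃))
      where
      two : ∀ x → + 2 * x ≡ x + x
      two = solve-∀
      l₁ : P L₁
      l₁ = Mean.mixed P mean (coef e₁) (P₁.q N i) i N h₁ m (suc n) ℕₚ.≤-refl
      l₂ : P L₂
      l₂ = Mean.mixed P mean (coef e₁) (P₁.q N i) i N h₁ n (suc m) (ℕₚ.≤-reflexive (index n m))
        where
        index : ∀ n m → suc (n ℕ.+ suc m) ≡ suc m ℕ.+ suc n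
        index = ℕ-Solver.solve-∀
      l₃ : P L₃
      l₃ = Mean.mixed P mean (coef e₂) (P₂.q N i) i N h₂ (m ℕ.+ suc n) 0
        (ℕₚ.≤-reflexive (cong suc (ℕₚ.+-identityʳ (m ℕ.+ suc n))))

  increasing : i ≤ peak N → 0ℤ ≤ᶻ lin -1ℤ (indepCoef (suc m) (suc n)) i
  increasing i≤ = *-cancelˡ-≤-pos 0ℤ _ (+ 6) (combine (0ℤ ≤ᶻ_)
    (λ z e p q → *-cancelˡ-≤-pos 0ℤ z (+ 2) (subst (0ℤ ≤ᶻ_) (sym e) (+-mono-≤ p q)))
    (λ K K<N → P₁.nonNeg-perturbed K<N i≤)
    (λ K K<N → P₂.nonNeg-perturbed K<N i≤)
    +-mono-≤)

  decreasing : 2 ℕ.+ peak N ≤ i → lin -1ℤ (indepCoef (suc m) (suc n)) i ≤ᶻ 0ℤ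
  decreasing ≤i = *-cancelˡ-≤-pos _ 0ℤ (+ 6) (combine (_≤ᶻ 0ℤ)
    (λ z e p q → *-cancelˡ-≤-pos z 0ℤ (+ 2) (subst (_≤ᶻ 0ℤ) (sym e) (+-mono-≤ p q)))
    (λ K K<N → P₁.nonPos-perturbed K<N ≤i)
    (λ K K<N → P₂.nonPos-perturbed K<N ≤i)
    +-mono-≤)

-- From the signs of differences to unimodality

-- If p exceeds d, then d itself is a peak: the size of the largest independent set never has to be computed.
unimodal : ∀ (a : ℕ → ℕ) (d p : ℕ) →
  (∀ i → i ℕ.< p → a i ≤ a (suc i)) → (∀ i → p ≤ i → a (suc i) ≤ a i) → Unimodal a d
unimodal a d p inc dec with ℕₚ.≤-total p d
... | inj₁ p≤d = p , p≤d , inc , λ i p≤i _ → dec i p≤i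
... | inj₂ d≤p = d , ℕₚ.≤-refl , (λ i i<d → inc i (ℕₚ.≤-trans i<d d≤p)) ,
  λ i d≤i i<d → contradiction d≤i (ℕₚ.<⇒≱ i<d)

unimodal-window : ∀ (a : ℕ → ℕ) (d p : ℕ) →
  (∀ i → i ℕ.< p → a i ≤ a (suc i)) → (∀ i → p ℕ.< i → a (suc i) ≤ a i) → Unimodal a d
unimodal-window a d p inc dec with ℕₚ.≤-total (a p) (a (suc p))
... | inj₁ ap≤ = unimodal a d (suc p) inc′ dec
  where
  inc′ : ∀ i → i ℕ.< suc p → a i ≤ a (suc i)
  inc′ i i<1+p with ℕₚ.m≤n⇒m<n∨m≡n (ℕ.s≤s⁻¹ i<1+p)
  ... | inj₁ i<p  = inc i i<p
  ... | inj₂ refl = ap≤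
... | inj₂ ap≥ = unimodal a d p inc dec′
  where
  dec′ : ∀ i → p ≤ i → a (suc i) ≤ a i
  dec′ i p≤i with ℕₚ.m≤n⇒m<n∨m≡n p≤i
  ... | inj₁ p<i  = dec i p<i
  ... | inj₂ refl = ap≥

theorem1p5 : (m n : ℕ) → 1 ≤ m → 1 ≤ n → IndepPolyUnimodal (Tstar m n)
theorem1p5 (suc m) (suc n) _ _ = unimodal-window (indepCount G) (indepNumber G) (peak (suc m ℕ.+ suc n))
  -- Index `suc i` of the differences compares coefficients i and i + 1: i < p means suc i ≤ p, and
  -- p < i means 2 + p ≤ suc i, so only i = p is left open.
  (λ i i<p → drop‿+≤+ (0≤i-j⇒j≤i (subst (0ℤ ≤ᶻ_) (difference i) (increasing m n (suc i) i<p))))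
  (λ i p<i → drop‿+≤+ (i-j≤0⇒i≤j (subst (_≤ᶻ 0ℤ) (difference i) (decreasing m n (suc i) (s≤s p<i)))))
  where
  G = Tstar (suc m) (suc n)
  difference : ∀ i → lin -1ℤ (indepCoef (suc m) (suc n)) (suc i) ≡ + indepCount G (suc i) - + indepCount G i
  difference i = trans (lemma (indepCoef (suc m) (suc n) (suc i)) (indepCoef (suc m) (suc n) i))
    (sym (cong₂ _-_ (indepCount-Tstar (suc m) (suc n) (suc i)) (indepCount-Tstar (suc m) (suc n) i)))
    where
    lemma : ∀ x y → x + -1ℤ * y ≡ x - y
    lemma = solve-∀
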